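{- Let $p$ be a prime, $m\ge1$ an integer ($m\ge2$ if $p=2$), $\gamma$ a primitive element of $\mathbb F_{p^m}$, $n\ge2$ a divisor of $p^m-1$, and $s=(p^m-1)/n$. Let $\mathcal A_1=\{\gamma^{nt}:t\in\mathbb Z\}$ and $\mathcal A_k=\gamma^{k-1}\mathcal A_1$ for $1\le k\le n$. Writing each $\beta\in\mathbb F_{p^m}$ as $\beta=\sum_{i=1}^m b_i\gamma^{i-1}$ with $b_i\in\{0,\dots,p-1\}$, let $q_k(x_1,\dots,x_m)=\sum_{\beta\in\mathcal A_k}\prod_{i=1}^m x_i^{b_i}$ for $1\le k\le n$ and $q_0=1$, and let $\mathbf V_{n+1}$ be the $\mathbb Q$-span of $q_0,\dots,q_n$ in $R=\mathbb Q[x_1,\dots,x_m]/\langle x_1^p-1,\dots,x_m^p-1\rangle$. Then $\mathbf V_{n+1}$ is a $\mathbb Q$-subalgebra of $R$; in particular, for all $1\le i,j\le n$ there are integers $c_{ijk}$ ($0\le k\le n$) with $$q_iq_j \bmod \langle x_1^p-1,\dots,x_m^p-1\rangle = c_{ij0}+\sum_{k=1}^n c_{ijk}q_k.$$ Moreover: (a) if $p$ is odd and $s$ is even, then $c_{ii0}=s$ and $c_{ij0}=0$ for all $j\ne i$; if $p$ is odd and $s$ is odd, then $c_{ii0}=0$ and $c_{ij0}=s$ for a suitable $j\ne i$; (b) if $p=2$ (in which case $s$ is always odd), then $c_{ii0}=s$ and $c_{ij0}=0$ for all $j\ne i$.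
   Context: The $\mathcal A_k$ are the fibers of the multiplicative character of order $n$ on $\mathbb F_{p^m}^*$ sending $\gamma\mapsto e^{2\pi i/n}$; $q_k$ is the multivariate characteristic polynomial of $\mathcal A_k$ and $q_0=1$ is that of $\{0\}$. -}

module Defs where

open import Algebra.Bundles using (CommutativeRing)
import Algebra.Definitions as Definitions
import Algebra.Properties.CommutativeSemigroup as CommutativeSemigroupProperties
import Algebra.Properties.Group as GroupProperties
import Algebra.Properties.Semiring.Exp as Exponentiation
import Algebra.Properties.Semiring.Mult as Multiplication
import Algebra.Properties.Semiring.Sum as Summation
open import Data.Empty using (⊥-elim)
open import Data.Fin.Base as Fin using (Fin; zero; suc; toℕ; fromℕ<; finToFun; funToFin)
import Data.Fin.Permutation as Perm
import Data.Fin.Properties as Fin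
open import Data.Integer.Base as ℤ using (ℤ; +_; -[1+_])
import Data.Integer.Properties as ℤ
open import Data.List.Base as List using (List; []; _∷_; _++_)
open import Data.Nat.Base as ℕ using (ℕ; zero; suc; NonZero)
import Data.Nat.Coprimality as Coprimality
open import Data.Nat.DivMod using (_/_; _%_; m≡m%n+[m/n]*n; m%n<n)
open import Data.Nat.GCD using (module Bézout)
open import Data.Nat.Primality using (Prime; prime⇒nonZero)
import Data.Nat.Properties as ℕ
open import Data.Product using (∃-syntax; Σ-syntax; _×_; _,_; proj₁; proj₂)
open import Data.Rational.Base as ℚ using (ℚ; 0ℚ; 1ℚ)
open import Data.Sum.Base using (_⊎_; inj₁; inj₂)
open import Data.Vec.Base as Vec using (Vec; _[_]≔_)
import Data.Vec.Properties as Vec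
open import Function.Base using (_∘_)
open import Function.Bundles using (Inverse)
open import Level using (Level; _⊔_)
open import Relation.Binary.Definitions using (tri<; tri≈; tri>)
open import Relation.Binary.PropositionalEquality as ≡ using (_≡_; _≗_)
import Relation.Binary.Reasoning.Setoid as SetoidReasoning
open import Relation.Nullary using (¬_; Dec; yes; no)
open import Relation.Nullary.Decidable using (map′)
open import Relation.Unary using (Pred; Decidable)

private
  variable
    m r : ℕ
    a ℓa : Level

-- A polynomial in ℚ[x₁,…,xₘ] is a finite list of terms (coefficient , exponent vector);
-- an exponent vector may occur several times, so polynomials are
-- compared with _≈ₚ_ and not with _≡_.
Poly : ℕ → Set
Poly m = List (ℚ × Vec ℕ m)

coeff : Poly m → Vec ℕ m → ℚ
coeff []            e = 0ℚ
coeff ((c , d) ∷ f) e with Vec.≡-dec ℕ._≟_ d e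
... | yes _ = c ℚ.+ coeff f e
... | no  _ = coeff f e

infix  4 _≈ₚ_
infixl 6 _+ₚ_ _-ₚ_
infixl 7 _*ₚ_ _•ₚ_

_≈ₚ_ : Poly m → Poly m → Set
f ≈ₚ g = ∀ e → coeff f e ≡ coeff g e

_+ₚ_ : Poly m → Poly m → Poly m
_+ₚ_ = _++_

_•ₚ_ : ℚ → Poly m → Poly m
c •ₚ f = List.map (λ (d , e) → c ℚ.* d , e) f

_-ₚ_ : Poly m → Poly m → Poly m
f -ₚ g = f +ₚ (ℚ.- 1ℚ) •ₚ g

_*ₚ_ : Poly m → Poly m → Poly m
_*ₚ_ = List.cartesianProductWith (λ (c , d) (c′ , d′) → c ℚ.* c′ , Vec.zipWith ℕ._+_ d d′)

monomial : Vec ℕ m → Poly m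
monomial e = List.[ 1ℚ , e ]

const : ℚ → Poly m
const c = List.[ c , Vec.replicate _ 0 ]

0ₚ 1ₚ : Poly m
0ₚ = []
1ₚ = const 1ℚ

sumₚ : List (Poly m) → Poly m
sumₚ = List.concat

∑ₚ : (Fin r → Poly m) → Poly m
∑ₚ f = sumₚ (List.tabulate f)

_∈⟨_⟩ : Poly m → (Fin r → Poly m) → Set
_∈⟨_⟩ {m} {r} f g = Σ[ h ∈ (Fin r → Poly m) ] f ≈ₚ ∑ₚ (λ i → h i *ₚ g i)

xᵖ-1 : (p m : ℕ) → Fin m → Poly m
xᵖ-1 p m i = monomial (Vec.replicate m 0 [ i ]≔ p) -ₚ 1ₚ

-- Equality in R = ℚ[x₁,…,xₘ] / ⟨x₁ᵖ - 1,…,xₘᵖ - 1⟩; subsets of R are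
-- predicates on Poly m respecting it.
infix 4 _≡_mod[x^_-1]

_≡_mod[x^_-1] : Poly m → Poly m → ℕ → Set
_≡_mod[x^_-1] {m} f g p = (f -ₚ g) ∈⟨ xᵖ-1 p m ⟩

Span : (p : ℕ) → (Fin r → Poly m) → Pred (Poly m) Level.zero
Span {r} p v f = Σ[ a ∈ (Fin r → ℚ) ] f ≡ ∑ₚ (λ k → a k •ₚ v k) mod[x^ p -1]

record IsSubalgebra (p m : ℕ) (V : Pred (Poly m) a) : Set a where
  field
    resp     : ∀ {f g} → f ≡ g mod[x^ p -1] → V f → V g
    0-closed : V 0ₚ
    1-closed : V 1ₚ
    +-closed : ∀ {f g} → V f → V g → V (f +ₚ g)
    •-closed : ∀ c {f} → V f → V (c •ₚ f)
    *-closed : ∀ {f g} → V f → V g → V (f *ₚ g)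

record IsFiniteField (F : CommutativeRing a ℓa) (N : ℕ) : Set (a ⊔ ℓa) where
  open CommutativeRing F
  open Exponentiation semiring using (_^_)
  field
    0≉1         : ¬ 0# ≈ 1#
    invertible  : ∀ x → ¬ x ≈ 0# → Definitions.Invertible _≈_ 1# _*_ x
    enumeration : Inverse setoid (≡.setoid (Fin N))

  powℤ : ∀ x → ¬ x ≈ 0# → ℤ → Carrier
  powℤ x x≉0 (+ k)    = x ^ k
  powℤ x x≉0 -[1+ k ] = proj₁ (invertible x x≉0) ^ suc k

record IsPrimitive {F : CommutativeRing a ℓa} {N : ℕ} (isFF : IsFiniteField F N)
                   (γ : CommutativeRing.Carrier F) : Set (a ⊔ ℓa) where
  open CommutativeRing F
  open IsFiniteField isFF
  field
    γ≉0       : ¬ γ ≈ 0#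
    generates : ∀ x → ¬ x ≈ 0# → ∃[ t ] x ≈ powℤ γ γ≉0 t

module PrimitiveElement
  {F : CommutativeRing a ℓa} {p m : ℕ} (pr : Prime p) (isFF : IsFiniteField F (p ℕ.^ m))
  {γ : CommutativeRing.Carrier F} (prim : IsPrimitive isFF γ) where

  open CommutativeRing F hiding (zero)
  open IsFiniteField isFF
  open IsPrimitive prim
  open Inverse enumeration using (to; from; to-cong; strictlyInverseˡ; strictlyInverseʳ)
  open Exponentiation semiring
  open Multiplication semiring renaming (_×_ to _×ₙ_)
  open Summation semiring

  value : (Fin m → Fin p) → Carrier
  value b = ∑[ i < m ] (toℕ (b i) ×ₙ γ ^ toℕ i)

  open SetoidReasoning setoid
  open CommutativeSemigroupProperties +-commutativeSemigroup using (interchange)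
  open GroupProperties +-group using () renaming (∙-cancelˡ to +-cancelˡ)
  open CommutativeSemigroupProperties *-commutativeSemigroup using () renaming (x∙yz≈y∙xz to *-left-comm)

  instance
    p≢0 : NonZero p
    p≢0 = prime⇒nonZero pr

  N : ℕ
  N = p ℕ.^ m

  to-injective : ∀ {x y} → to x ≡ to y → x ≈ y
  to-injective {x} {y} eq = begin
    x           ≈⟨ strictlyInverseʳ x ⟨
    from (to x) ≡⟨ ≡.cong from eq ⟩
    from (to y) ≈⟨ strictlyInverseʳ y ⟩
    y           ∎

  δ : Carrier
  δ = proj₁ (invertible γ γ≉0)

  γδ≈1 : γ * δ ≈ 1#
  γδ≈1 = proj₂ (proj₂ (invertible γ γ≉0))

  δγ≈1 : δ * γ ≈ 1#
  δγ≈1 = proj₁ (proj₂ (invertible γ γ≉0))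

  δγx≈x : ∀ x → δ * (γ * x) ≈ x
  δγx≈x x = trans (sym (*-assoc δ γ x)) (trans (*-congʳ δγ≈1) (*-identityˡ x))

  1^ : ∀ k → 1# ^ k ≈ 1#
  1^ zero    = refl
  1^ (suc k) = trans (*-identityˡ _) (1^ k)

  ^-inv : ∀ {u v} → v * u ≈ 1# → ∀ k x → v ^ k * (u ^ k * x) ≈ x
  ^-inv vu zero    x = trans (*-identityˡ _) (*-identityˡ x)
  ^-inv {u} {v} vu (suc k) x = begin
    (v * v ^ k) * ((u * u ^ k) * x) ≈⟨ *-assoc _ _ _ ⟩
    v * (v ^ k * ((u * u ^ k) * x)) ≈⟨ *-congˡ (*-congˡ (*-assoc _ _ _)) ⟩
    v * (v ^ k * (u * (u ^ k * x))) ≈⟨ *-congˡ (*-left-comm _ _ _) ⟩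
    v * (u * (v ^ k * (u ^ k * x))) ≈⟨ *-assoc _ _ _ ⟨
    (v * u) * (v ^ k * (u ^ k * x)) ≈⟨ *-cong vu (^-inv vu k x) ⟩
    1# * x                          ≈⟨ *-identityˡ x ⟩
    x                               ∎

  finite-order : ∀ {u v} → v * u ≈ 1# → ∃[ d ] u ^ suc d ≈ 1#
  finite-order {u} {v} vu
    with i , j , i<j , eq ← Fin.pigeonhole (ℕ.n<1+n N) (λ i → to (u ^ toℕ i))
    with d , j≡ ← ℕ.m≤n⇒∃[o]m+o≡n i<j = d , (begin
      u ^ suc d                                  ≈⟨ ^-inv vu (toℕ i) _ ⟨
      v ^ toℕ i * (u ^ toℕ i * u ^ suc d)        ≈⟨ *-congˡ (^-homo-* u (toℕ i) (suc d)) ⟨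
      v ^ toℕ i * u ^ (toℕ i ℕ.+ suc d)          ≡⟨ ≡.cong (λ k → v ^ toℕ i * u ^ k) (≡.trans (ℕ.+-suc (toℕ i) d) j≡) ⟩
      v ^ toℕ i * u ^ toℕ j                      ≈⟨ *-congˡ (to-injective eq) ⟨
      v ^ toℕ i * u ^ toℕ i                      ≈⟨ *-congˡ (*-identityʳ _) ⟨
      v ^ toℕ i * (u ^ toℕ i * 1#)               ≈⟨ ^-inv vu (toℕ i) 1# ⟩
      1#                                         ∎)

  inverse-power : ∀ {u v} → v * u ≈ 1# → ∀ d → u ^ suc d ≈ 1# → v ≈ u ^ d
  inverse-power {u} {v} vu d eq = begin
    v              ≈⟨ *-identityʳ v ⟨
    v * 1#         ≈⟨ *-congˡ eq ⟨
    v * (u * u ^ d) ≈⟨ *-assoc _ _ _ ⟨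
    (v * u) * u ^ d ≈⟨ *-congʳ vu ⟩
    1# * u ^ d     ≈⟨ *-identityˡ _ ⟩
    u ^ d          ∎

  infix 4 _≈?_

  _≈?_ : ∀ x y → Dec (x ≈ y)
  x ≈? y = map′ to-injective to-cong (to x Fin.≟ to y)

  translate : Perm.Permutation N N
  translate = Perm.permutation (λ i → to (from i + 1#)) (λ i → to (from i - 1#))
    (λ i → ≡.trans (to-cong (begin
       from (to (from i - 1#)) + 1# ≈⟨ +-congʳ (strictlyInverseʳ _) ⟩
       (from i - 1#) + 1#           ≈⟨ +-assoc _ _ _ ⟩
       from i + (- 1# + 1#)         ≈⟨ +-congˡ (-‿inverseˡ 1#) ⟩
       from i + 0#                  ≈⟨ +-identityʳ _ ⟩
       from i                       ∎)) (strictlyInverseˡ i))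
    (λ i → ≡.trans (to-cong (begin
       from (to (from i + 1#)) - 1# ≈⟨ +-congʳ (strictlyInverseʳ _) ⟩
       (from i + 1#) - 1#           ≈⟨ +-assoc _ _ _ ⟩
       from i + (1# - 1#)           ≈⟨ +-congˡ (-‿inverseʳ 1#) ⟩
       from i + 0#                  ≈⟨ +-identityʳ _ ⟩
       from i                       ∎)) (strictlyInverseˡ i))

  N×1≈0 : N ×ₙ 1# ≈ 0#
  N×1≈0 = +-cancelˡ (sum from) _ _ (begin
    sum from + N ×ₙ 1#                        ≈⟨ +-congˡ (sum-replicate N) ⟨
    sum from + ∑[ i < N ] 1#                  ≈⟨ ∑-distrib-+ from (λ _ → 1#) ⟨
    ∑[ i < N ] (from i + 1#)                  ≈⟨ sum-cong-≋ (λ i → strictlyInverseʳ (from i + 1#)) ⟨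
    ∑[ i < N ] (from (to (from i + 1#)))      ≈⟨ sum-permute from translate ⟨
    sum from                                  ≈⟨ +-identityʳ _ ⟨
    sum from + 0#                             ∎)

  integral : ∀ x y → x * y ≈ 0# → x ≈ 0# ⊎ y ≈ 0#
  integral x y xy≈0 with x ≈? 0#
  ... | yes x≈0 = inj₁ x≈0
  ... | no  x≉0 with x⁻¹ , x⁻¹x , _ ← invertible x x≉0 = inj₂ (begin
    y             ≈⟨ *-identityˡ y ⟨
    1# * y        ≈⟨ *-congʳ x⁻¹x ⟨
    (x⁻¹ * x) * y ≈⟨ *-assoc _ _ _ ⟩
    x⁻¹ * (x * y) ≈⟨ *-congˡ xy≈0 ⟩
    x⁻¹ * 0#      ≈⟨ zeroʳ _ ⟩
    0#            ∎)

  p×1≈0 : p ×ₙ 1# ≈ 0#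
  p×1≈0 = go m N×1≈0
    where
    go : ∀ k → (p ℕ.^ k) ×ₙ 1# ≈ 0# → p ×ₙ 1# ≈ 0#
    go zero    eq = ⊥-elim (0≉1 (trans (sym eq) (+-identityʳ 1#)))
    go (suc k) eq with integral (p ×ₙ 1#) ((p ℕ.^ k) ×ₙ 1#) (trans (sym (×1-homo-* p (p ℕ.^ k))) eq)
    ... | inj₁ done = done
    ... | inj₂ eq′  = go k eq′

  p×≈0 : ∀ x → p ×ₙ x ≈ 0#
  p×≈0 x = begin
    p ×ₙ x         ≈⟨ ×-congʳ p (*-identityˡ x) ⟨
    p ×ₙ (1# * x)  ≈⟨ ×-assoc-* p 1# x ⟨
    (p ×ₙ 1#) * x  ≈⟨ *-congʳ p×1≈0 ⟩
    0# * x         ≈⟨ zeroˡ x ⟩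
    0#             ∎

  ×0≈0 : ∀ k → k ×ₙ 0# ≈ 0#
  ×0≈0 zero    = refl
  ×0≈0 (suc k) = trans (+-identityˡ _) (×0≈0 k)

  kp×≈0 : ∀ k x → (k ℕ.* p) ×ₙ x ≈ 0#
  kp×≈0 k x = begin
    (k ℕ.* p) ×ₙ x  ≈⟨ ×-assocˡ x k p ⟨
    k ×ₙ (p ×ₙ x)   ≈⟨ ×-congʳ k (p×≈0 x) ⟩
    k ×ₙ 0#         ≈⟨ ×0≈0 k ⟩
    0#              ∎

  negate : Carrier → Carrier
  negate x = ℕ.pred p ×ₙ x

  negate-inverse : ∀ x → x + negate x ≈ 0#
  negate-inverse x = trans (×-congˡ {x} (ℕ.suc-pred p)) (p×≈0 x)

  %-×1 : ∀ k → (k % p) ×ₙ 1# ≈ k ×ₙ 1#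
  %-×1 k = sym (begin
    k ×ₙ 1#                                   ≡⟨ ≡.cong (_×ₙ 1#) (m≡m%n+[m/n]*n k p) ⟩
    (k % p ℕ.+ k / p ℕ.* p) ×ₙ 1#             ≈⟨ ×-homo-+ 1# (k % p) _ ⟩
    (k % p) ×ₙ 1# + (k / p ℕ.* p) ×ₙ 1#       ≈⟨ +-congˡ (kp×≈0 (k / p) 1#) ⟩
    (k % p) ×ₙ 1# + 0#                        ≈⟨ +-identityʳ _ ⟩
    (k % p) ×ₙ 1#                             ∎)

  -- S d is the set of ℕ-combinations of 1, γ, …, γ^(d-1).
  S : ℕ → Pred Carrier (a ⊔ ℓa)
  S zero    x = Level.Lift (a ⊔ ℓa) (x ≈ 0#)
  S (suc d) x = ∃[ k ] ∃[ y ] (S d y × x ≈ k ×ₙ 1# + γ * y)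

  S-resp : ∀ d {x y} → x ≈ y → S d x → S d y
  S-resp zero    x≈y (Level.lift x≈0)    = Level.lift (trans (sym x≈y) x≈0)
  S-resp (suc d) x≈y (k , z , Sz , eq) = k , z , Sz , trans (sym x≈y) eq

  S-0 : ∀ d → S d 0#
  S-0 zero    = Level.lift refl
  S-0 (suc d) = 0 , 0# , S-0 d , sym (trans (+-identityˡ _) (zeroʳ γ))

  S-1 : ∀ d → S (suc d) 1#
  S-1 d = 1 , 0# , S-0 d , sym (trans (+-cong (+-identityʳ 1#) (zeroʳ γ)) (+-identityʳ 1#))

  S-+ : ∀ d {x y} → S d x → S d y → S d (x + y)
  S-+ zero    (Level.lift x≈0) (Level.lift y≈0) = Level.lift (trans (+-cong x≈0 y≈0) (+-identityˡ 0#))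
  S-+ (suc d) {x} {y} (k , x′ , Sx , eqx) (l , y′ , Sy , eqy) = k ℕ.+ l , x′ + y′ , S-+ d Sx Sy , (begin
    x + y                                         ≈⟨ +-cong eqx eqy ⟩
    (k ×ₙ 1# + γ * x′) + (l ×ₙ 1# + γ * y′)       ≈⟨ interchange _ _ _ _ ⟩
    (k ×ₙ 1# + l ×ₙ 1#) + (γ * x′ + γ * y′)       ≈⟨ +-cong (×-homo-+ 1# k l) (distribˡ γ x′ y′) ⟨
    (k ℕ.+ l) ×ₙ 1# + γ * (x′ + y′)               ∎)

  S-× : ∀ d k {x} → S d x → S d (k ×ₙ x)
  S-× d zero    Sx = S-0 d
  S-× d (suc k) Sx = S-+ d Sx (S-× d k Sx)

  S-suc : ∀ d {x} → S d x → S (suc d) x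
  S-suc zero    (Level.lift x≈0)    = S-resp 1 (sym x≈0) (S-0 1)
  S-suc (suc d) (k , y , Sy , eq) = k , y , S-suc d Sy , eq

  module _ {e} (Sδ : S e δ) where
    S-δ* : ∀ {x} → S e x → S e (δ * x)
    S-δ* {x} Sx = go e ≡.refl Sx
      where
      go : ∀ d → e ≡ d → S d x → S e (δ * x)
      go zero    ≡.refl (Level.lift x≈0) = Level.lift (trans (*-congˡ x≈0) (zeroʳ δ))
      go (suc d) ≡.refl (k , y , Sy , eq) =
        S-resp e (sym (begin
          δ * x                           ≈⟨ *-congˡ eq ⟩
          δ * (k ×ₙ 1# + γ * y)           ≈⟨ distribˡ _ _ _ ⟩
          δ * (k ×ₙ 1#) + δ * (γ * y)     ≈⟨ +-cong (×-comm-* k δ 1#) (δγx≈x y) ⟩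
          k ×ₙ (δ * 1#) + y               ≈⟨ +-congʳ (×-congʳ k (*-identityʳ δ)) ⟩
          k ×ₙ δ + y                      ∎))
          (S-+ e (S-× e k Sδ) (S-suc d Sy))

    S-one : S e 1#
    S-one = go e ≡.refl Sδ
      where
      go : ∀ d → e ≡ d → S d δ → S e 1#
      go zero    ≡.refl (Level.lift δ≈0) = ⊥-elim (0≉1 (sym (trans (sym γδ≈1) (trans (*-congˡ δ≈0) (zeroʳ γ)))))
      go (suc d) ≡.refl _                = S-1 d

    S-δ^ : ∀ k → S e (δ ^ k)
    S-δ^ zero    = S-one
    S-δ^ (suc k) = S-δ* (S-δ^ k)

    S-full : ∀ x → S e x
    S-full x with x ≈? 0#
    ... | yes x≈0 = S-resp e (sym x≈0) (S-0 e)
    ... | no  x≉0 with generates x x≉0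
    ...   | -[1+ k ] , eq = S-resp e (sym eq) (S-δ^ (suc k))
    ...   | + k , eq with d , δ^ ← finite-order γδ≈1 = S-resp e (sym (begin
      x             ≈⟨ eq ⟩
      γ ^ k         ≈⟨ ^-congˡ k (inverse-power γδ≈1 d δ^) ⟩
      (δ ^ d) ^ k   ≈⟨ ^-assocʳ δ d k ⟩
      δ ^ (d ℕ.* k) ∎)) (S-δ^ (d ℕ.* k))

  val : ∀ d → (Fin d → Fin p) → Carrier
  val d b = ∑[ i < d ] (toℕ (b i) ×ₙ γ ^ toℕ i)

  val-suc : ∀ d b → val (suc d) b ≈ toℕ (b zero) ×ₙ 1# + γ * val d (b ∘ suc)
  val-suc d b = +-congˡ (sym (trans (*-distribˡ-sum {d} γ (λ i → toℕ (b (suc i)) ×ₙ γ ^ toℕ i))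
    (sum-cong-≋ (λ i → ×-comm-* (toℕ (b (suc i))) γ (γ ^ toℕ i)))))

  val-S : ∀ d b → S d (val d b)
  val-S zero    b = Level.lift refl
  val-S (suc d) b = toℕ (b zero) , val d (b ∘ suc) , val-S d (b ∘ suc) , val-suc d b

  S-val : ∀ d {x} → S d x → ∃[ b ] val d b ≈ x
  S-val zero    (Level.lift x≈0) = (λ ()) , sym x≈0
  S-val (suc d) {x} (k , y , Sy , eq) with b , valb≈y ← S-val d Sy = b′ , (begin
    val (suc d) b′                 ≈⟨ val-suc d b′ ⟩
    toℕ (b′ zero) ×ₙ 1# + γ * val d b ≡⟨ ≡.cong (λ l → l ×ₙ 1# + γ * val d b) (Fin.toℕ-fromℕ< (m%n<n k p)) ⟩
    (k % p) ×ₙ 1# + γ * val d b    ≈⟨ +-cong (%-×1 k) (*-congˡ valb≈y) ⟩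
    k ×ₙ 1# + γ * y                ≈⟨ eq ⟨
    x                              ∎)
    where
    b′ : Fin (suc d) → Fin p
    b′ zero    = fromℕ< (m%n<n k p)
    b′ (suc i) = b i

  unit-digit : ∀ d x k .{{_ : NonZero k}} → k ℕ.< p → S d (k ×ₙ x) → S d x
  unit-digit d x k k<p Skx with Coprimality.coprime-Bézout (Coprimality.prime⇒coprime pr k<p)
  ... | Bézout.-+ u v eq = S-resp d (begin
    v ×ₙ (k ×ₙ x)               ≈⟨ ×-assocˡ x v k ⟩
    (v ℕ.* k) ×ₙ x              ≡⟨ ≡.cong (_×ₙ x) eq ⟨
    x + (u ℕ.* p) ×ₙ x          ≈⟨ +-congˡ (kp×≈0 u x) ⟩
    x + 0#                      ≈⟨ +-identityʳ x ⟩
    x                           ∎) (S-× d v Skx)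
  ... | Bézout.+- u v eq = S-resp d (begin
    negate (v ×ₙ (k ×ₙ x))                            ≈⟨ +-identityʳ _ ⟨
    negate w + 0#                                     ≈⟨ +-congˡ (kp×≈0 u x) ⟨
    negate w + (u ℕ.* p) ×ₙ x                         ≡⟨ ≡.cong (λ l → negate w + l ×ₙ x) eq ⟨
    negate w + (x + (v ℕ.* k) ×ₙ x)                   ≈⟨ +-congˡ (+-congˡ (×-assocˡ x v k)) ⟨
    negate w + (x + w)                                ≈⟨ +-congˡ (+-comm x w) ⟩
    negate w + (w + x)                                ≈⟨ +-assoc _ _ _ ⟨
    (negate w + w) + x                                ≈⟨ +-congʳ (trans (+-comm _ _) (negate-inverse w)) ⟩
    0# + x                                            ≈⟨ +-identityˡ x ⟩
    x                                                 ∎) (S-× d (ℕ.pred p) (S-× d v Skx))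
    where w = v ×ₙ (k ×ₙ x)

  leading : ∀ d {x y} → S d x → S d y → (k l : Fin p) → k Fin.< l →
            toℕ k ×ₙ 1# + γ * x ≈ toℕ l ×ₙ 1# + γ * y → S d δ
  leading d {x} {y} Sx Sy k l k<l eq with c , l≡ ← ℕ.m≤n⇒∃[o]m+o≡n k<l =
    unit-digit d δ (suc c) c<p (S-resp d (begin
      x + negate y                                     ≈⟨ +-congʳ (δγx≈x x) ⟨
      δ * (γ * x) + negate y                           ≈⟨ +-congʳ (*-congˡ γx≈) ⟩
      δ * (suc c ×ₙ 1# + γ * y) + negate y             ≈⟨ +-congʳ (distribˡ _ _ _) ⟩
      (δ * (suc c ×ₙ 1#) + δ * (γ * y)) + negate y     ≈⟨ +-assoc _ _ _ ⟩
      δ * (suc c ×ₙ 1#) + (δ * (γ * y) + negate y)     ≈⟨ +-cong (×-comm-* (suc c) δ 1#) (+-congʳ (δγx≈x y)) ⟩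
      suc c ×ₙ (δ * 1#) + (y + negate y)               ≈⟨ +-cong (×-congʳ (suc c) (*-identityʳ δ)) (negate-inverse y) ⟩
      suc c ×ₙ δ + 0#                                  ≈⟨ +-identityʳ _ ⟩
      suc c ×ₙ δ                                       ∎)
      (S-+ d Sx (S-× d (ℕ.pred p) Sy)))
    where
    l≡k+c : toℕ l ≡ toℕ k ℕ.+ suc c
    l≡k+c = ≡.trans (≡.sym l≡) (≡.sym (ℕ.+-suc (toℕ k) c))
    c<p : suc c ℕ.< p
    c<p = ℕ.≤-<-trans (ℕ.≤-trans (ℕ.m≤n+m (suc c) (toℕ k)) (ℕ.≤-reflexive (≡.sym l≡k+c))) (Fin.toℕ<n l)
    γx≈ : γ * x ≈ suc c ×ₙ 1# + γ * y
    γx≈ = +-cancelˡ (toℕ k ×ₙ 1#) _ _ (begin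
      toℕ k ×ₙ 1# + γ * x                       ≈⟨ eq ⟩
      toℕ l ×ₙ 1# + γ * y                       ≡⟨ ≡.cong (λ z → z ×ₙ 1# + γ * y) l≡k+c ⟩
      (toℕ k ℕ.+ suc c) ×ₙ 1# + γ * y           ≈⟨ +-congʳ (×-homo-+ 1# (toℕ k) (suc c)) ⟩
      (toℕ k ×ₙ 1# + suc c ×ₙ 1#) + γ * y       ≈⟨ +-assoc _ _ _ ⟩
      toℕ k ×ₙ 1# + (suc c ×ₙ 1# + γ * y)       ∎)

  collision : ∀ d (b b′ : Fin d → Fin p) → val d b ≈ val d b′ → b ≗ b′ ⊎ S d δ
  collision zero    b b′ eq = inj₁ (λ ())
  collision (suc d) b b′ eq with Fin.<-cmp (b zero) (b′ zero)
  ... | tri< k<l _ _ = inj₂ (S-suc d (leading d (val-S d (b ∘ suc)) (val-S d (b′ ∘ suc)) _ _ k<l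
                         (trans (sym (val-suc d b)) (trans eq (val-suc d b′)))))
  ... | tri> _ _ l<k = inj₂ (S-suc d (leading d (val-S d (b′ ∘ suc)) (val-S d (b ∘ suc)) _ _ l<k
                         (trans (sym (val-suc d b′)) (trans (sym eq) (val-suc d b)))))
  ... | tri≈ _ b₀≡ _ = extend (collision d (b ∘ suc) (b′ ∘ suc) tails)
    where
    tails : val d (b ∘ suc) ≈ val d (b′ ∘ suc)
    tails = begin
      val d (b ∘ suc)              ≈⟨ δγx≈x _ ⟨
      δ * (γ * val d (b ∘ suc))    ≈⟨ *-congˡ (+-cancelˡ (toℕ (b zero) ×ₙ 1#) _ _ (begin
        toℕ (b zero) ×ₙ 1# + γ * val d (b ∘ suc)   ≈⟨ val-suc d b ⟨
        val (suc d) b                              ≈⟨ eq ⟩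
        val (suc d) b′                             ≈⟨ val-suc d b′ ⟩
        toℕ (b′ zero) ×ₙ 1# + γ * val d (b′ ∘ suc) ≡⟨ ≡.cong (λ k → toℕ k ×ₙ 1# + γ * val d (b′ ∘ suc)) b₀≡ ⟨
        toℕ (b zero) ×ₙ 1# + γ * val d (b′ ∘ suc)  ∎)) ⟩
      δ * (γ * val d (b′ ∘ suc))   ≈⟨ δγx≈x _ ⟩
      val d (b′ ∘ suc)             ∎

    extend : b ∘ suc ≗ b′ ∘ suc ⊎ S d δ → b ≗ b′ ⊎ S (suc d) δ
    extend (inj₁ same) = inj₁ (λ { zero → b₀≡ ; (suc i) → same i })
    extend (inj₂ Sδ)   = inj₂ (S-suc d Sδ)

  funToFin-cong : ∀ d {f g : Fin d → Fin p} → f ≗ g → funToFin f ≡ funToFin g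
  funToFin-cong zero    f≗g = ≡.refl
  funToFin-cong (suc d) f≗g = ≡.cong₂ Fin.combine (f≗g zero) (funToFin-cong d (f≗g ∘ suc))

  representation : ∀ β → ∃[ b ] β ≈ value b
  representation β = let i , j , i<j , eq = Fin.pigeonhole (ℕ.n<1+n N) holes in cases i j i<j eq
    where
    holes : Fin (suc N) → Fin N
    holes zero    = to β
    holes (suc i) = to (val m (finToFun i))

    cases : ∀ i j → i Fin.< j → holes i ≡ holes j → ∃[ b ] β ≈ value b
    cases zero    (suc j) i<j eq = finToFun j , to-injective eq
    cases (suc i) (suc j) i<j eq with collision m (finToFun i) (finToFun j) (to-injective eq)
    ... | inj₁ same = ⊥-elim (ℕ.<⇒≢ i<j (≡.cong (suc ∘ toℕ) (≡.trans (≡.sym (Fin.funToFin-finToFin {m} {p} i))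
                        (≡.trans (funToFin-cong m same) (Fin.funToFin-finToFin {m} {p} j)))))
    ... | inj₂ Sδ with b , eqb ← S-val m (S-full Sδ β) = b , sym eqb

  -- The bᵢ in β = Σᵢ bᵢ γ^(i-1).
  digits : Carrier → Fin m → Fin p
  digits β = proj₁ (representation β)

  elements : List Carrier
  elements = List.tabulate from

  charPoly : ∀ {b} {A : Pred Carrier b} → Decidable A → Poly m
  charPoly A? = sumₚ (List.map (λ β → monomial (Vec.tabulate (toℕ ∘ digits β))) (List.filter A? elements))

  module Cyclotomic (n : ℕ) where

    𝒜₁ : Pred Carrier _
    𝒜₁ β = ∃[ t ] β ≈ powℤ γ γ≉0 (+ n ℤ.* t)

    -- Indices are shifted by one: 𝒜 k, for k = 0,…,n-1, is 𝒜ₖ₊₁ = γᵏ𝒜₁.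
    𝒜 : Fin n → Pred Carrier _
    𝒜 k β = ∃[ α ] (𝒜₁ α × β ≈ γ ^ toℕ k * α)

    order : ℕ
    order = suc (proj₁ (finite-order δγ≈1))

    γ^order : γ ^ order ≈ 1#
    γ^order = proj₂ (finite-order δγ≈1)

    reduce : ∀ t → γ ^ (n ℕ.* t) ≈ γ ^ (n ℕ.* (t % order))
    reduce t = begin
      γ ^ (n ℕ.* t)                             ≡⟨ ≡.cong (γ ^_) exponent ⟩
      γ ^ (n ℕ.* (t % order) ℕ.+ order ℕ.* k)   ≈⟨ ^-homo-* γ (n ℕ.* (t % order)) _ ⟩
      γ ^ (n ℕ.* (t % order)) * γ ^ (order ℕ.* k) ≈⟨ *-congˡ (^-assocʳ γ order k) ⟨
      γ ^ (n ℕ.* (t % order)) * (γ ^ order) ^ k ≈⟨ *-congˡ (trans (^-congˡ k γ^order) (1^ k)) ⟩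
      γ ^ (n ℕ.* (t % order)) * 1#              ≈⟨ *-identityʳ _ ⟩
      γ ^ (n ℕ.* (t % order))                   ∎
      where
      k = n ℕ.* (t / order)
      exponent : n ℕ.* t ≡ n ℕ.* (t % order) ℕ.+ order ℕ.* k
      exponent = ≡.trans (≡.cong (n ℕ.*_) (m≡m%n+[m/n]*n t order))
        (≡.trans (ℕ.*-distribˡ-+ n (t % order) _)
          (≡.cong (n ℕ.* (t % order) ℕ.+_) (≡.trans (≡.sym (ℕ.*-assoc n (t / order) order)) (ℕ.*-comm k order))))

    powℤ-neg : ∀ k → powℤ γ γ≉0 (ℤ.- (+ k)) ≈ δ ^ k
    powℤ-neg zero    = refl
    powℤ-neg (suc k) = refl

    natural-exponent : ∀ t → ∃[ k ] powℤ γ γ≉0 (+ n ℤ.* t) ≈ γ ^ (n ℕ.* k)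
    natural-exponent (+ k)    = k , reflexive (≡.cong (powℤ γ γ≉0) (≡.sym (ℤ.pos-* n k)))
    natural-exponent -[1+ k ] = suc k ℕ.* d , (begin
      powℤ γ γ≉0 (+ n ℤ.* -[1+ k ])         ≡⟨ ≡.cong (powℤ γ γ≉0) (≡.trans (≡.sym (ℤ.neg-distribʳ-* (+ n) (+ suc k))) (≡.cong ℤ.-_ (≡.sym (ℤ.pos-* n (suc k))))) ⟩
      powℤ γ γ≉0 (ℤ.- (+ (n ℕ.* suc k)))    ≈⟨ powℤ-neg (n ℕ.* suc k) ⟩
      δ ^ (n ℕ.* suc k)                     ≈⟨ ^-congˡ (n ℕ.* suc k) (inverse-power δγ≈1 d γ^order) ⟩
      (γ ^ d) ^ (n ℕ.* suc k)               ≈⟨ ^-assocʳ γ d (n ℕ.* suc k) ⟩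
      γ ^ (d ℕ.* (n ℕ.* suc k))             ≡⟨ ≡.cong (γ ^_) (≡.trans (ℕ.*-comm d _) (ℕ.*-assoc n (suc k) d)) ⟩
      γ ^ (n ℕ.* (suc k ℕ.* d))             ∎)
      where d = proj₁ (finite-order δγ≈1)

    𝒜? : ∀ k → Decidable (𝒜 k)
    𝒜? k β = map′ sound complete (Fin.any? (λ (j : Fin order) → β ≈? γ ^ toℕ k * γ ^ (n ℕ.* toℕ j)))
      where
      sound : (∃[ j ] β ≈ γ ^ toℕ k * γ ^ (n ℕ.* toℕ {order} j)) → 𝒜 k β
      sound (j , eq) = _ , (+ toℕ j , reflexive (≡.cong (powℤ γ γ≉0) (ℤ.pos-* n (toℕ j)))) , eq

      complete : 𝒜 k β → ∃[ j ] β ≈ γ ^ toℕ k * γ ^ (n ℕ.* toℕ {order} j)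
      complete (α , (t , α≈) , β≈) with l , eq ← natural-exponent t = fromℕ< (m%n<n l order) , (begin
        β                                                          ≈⟨ β≈ ⟩
        γ ^ toℕ k * α                                              ≈⟨ *-congˡ (trans α≈ (trans eq (reduce l))) ⟩
        γ ^ toℕ k * γ ^ (n ℕ.* (l % order))                        ≡⟨ ≡.cong (λ z → γ ^ toℕ k * γ ^ (n ℕ.* z)) (Fin.toℕ-fromℕ< (m%n<n l order)) ⟨
        γ ^ toℕ k * γ ^ (n ℕ.* toℕ (fromℕ< (m%n<n l order)))       ∎)

    q : Fin (suc n) → Poly m
    q zero    = 1ₚ
    q (suc k) = charPoly (𝒜? k)

{-# OPTIONS --safe #-}
module Submission where

-- R is the rational group algebra of the additive group of the field: sending x^d to Σᵢ dᵢ γ^(i-1)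
-- identifies polynomials modulo ⟨x₁ᵖ - 1,…,xₘᵖ - 1⟩ with functionals Φ ↦ Σ c Φ(Σᵢ dᵢ γ^(i-1)), and qₖ
-- with Φ ↦ Σ_{x ∈ 𝒜ₖ} Φ(x). The coefficient of z in qᵢqⱼ is the number ν(z) of pairs
-- (x , y) ∈ 𝒜ᵢ × 𝒜ⱼ with x + y = z; since multiplication by an element of 𝒜₁ preserves every class,
-- ν is constant on {0}, 𝒜₁, …, 𝒜ₙ, and its values are the structure constants. The constant term
-- is ν(0) = #{x ∈ 𝒜ᵢ : -x ∈ 𝒜ⱼ}, which is governed by whether -1 ∈ 𝒜₁. Writing -1 = γᵉ, sn divides 2e
-- but, for p odd, not e, so n divides e exactly when s is even; for p = 2 one has e = 0.

open import Algebra.Bundles using (CommutativeMonoid; CommutativeRing)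
import Algebra.Properties.AbelianGroup as AbelianGroupProperties
import Algebra.Properties.CommutativeMonoid.Sum as CommutativeMonoidSum
import Algebra.Properties.Ring as RingProperties
import Algebra.Properties.Semiring.Exp as Exponentiation
import Algebra.Properties.Semiring.Mult as Multiplication
import Algebra.Properties.Semiring.Sum as Summation
open import Data.Bool.Base using (Bool; true; false; if_then_else_)
open import Data.Fin.Base as Fin using (Fin; zero; suc; toℕ; fromℕ<; finToFun; funToFin)
import Data.Fin.Permutation as Perm
import Data.Fin.Properties as Fin
open import Data.Integer.Base as ℤ using (ℤ; +_)
import Data.Integer.Properties as ℤ
open import Data.List.Base as List using ([]; _∷_)
import Data.List.Properties as List
open import Data.Nat.Base as ℕ using (ℕ; zero; suc; NonZero; s≤s)
open import Data.Nat.DivMod using (_%_; _mod_; m≡m%n+[m/n]*n; m%n<n; m<n⇒m%n≡m; %-remove-+ˡ; %-remove-+ʳ; %-distribˡ-+)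
open import Data.Nat.Divisibility as ∣ using (_∣_; divides; quotient)
open import Data.Nat.Primality using (Prime; prime[2]; euclidsLemma)
import Data.Nat.Properties as ℕ
open import Data.Product using (Σ-syntax; ∃-syntax; _×_; _,_; proj₁; proj₂)
open import Data.Rational.Base as ℚ using (ℚ; 0ℚ; 1ℚ; _/_)
import Data.Rational.Properties as ℚ
open import Data.Rational.Solver using (module +-*-Solver)
open import Data.Rational.Unnormalised.Base as ℚᵘ using (mkℚᵘ; *≡*)
import Data.Rational.Unnormalised.Properties as ℚᵘ
open import Data.Sum.Base using (_⊎_; inj₁; inj₂)
open import Data.Vec.Base as Vec using (Vec; []; _∷_; _[_]≔_)
import Data.Vec.Properties as Vec
open import Function.Base using (_∘_)
open import Function.Bundles using (Inverse; mk⇔)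
open import Relation.Binary.PropositionalEquality as ≡ using (_≡_; _≢_; refl; sym; trans; cong; cong₂; module ≡-Reasoning)
import Relation.Binary.Reasoning.Setoid as SetoidReasoning
open import Relation.Nullary using (Dec; does; yes; no; ¬_; contradiction)
open import Relation.Nullary.Decidable using (¬?; dec-true; dec-false; does-⇔)
open import Relation.Unary using (Decidable; Pred)
open import Defs

open ≡-Reasoning
open +-*-Solver using (solve; _:=_; _:+_; _:*_; :-_; con)

-- The delicate direction is the return from functionals to ideal membership, which demands explicit
-- cofactors. It works because reducing exponents modulo p, a step whose cofactors are known, leaves
-- one exponent vector per field element: there are p^m digit vectors and p^m elements, and every
-- element has digits, so by counting the digits are unique. Functionals are preferred to
-- coefficients because a product becomes an iterated evaluation, whatever repetitions the lists of
-- terms contain. The divisibility arguments about logarithms rest on the order of γ being exactly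
-- p^m - 1, which comes from two further counting arguments, one for each inequality.

module Σℚ = Summation (CommutativeRing.semiring ℚ.+-*-commutativeRing)
module Σℕ = Summation ℕ.+-*-semiring

private
  variable
    m r : ℕ

-- Finite sums, remainders and digit vectors

module _ {c ℓ} (M : CommutativeMonoid c ℓ) where
  private module M = CommutativeMonoid M
  open CommutativeMonoidSum M using (sum; sum-replicate-zero)

  -- The condition is the boolean `does`, which computes through `suc`, so the tail of the sum at
  -- `suc i` is definitionally the sum at `i`. The monoid is arbitrary because both rational values
  -- and natural counts are summed this way.
  sum-indicator : (i : Fin r) (f : Fin r → M.Carrier) →
                  sum (λ j → if does (i Fin.≟ j) then f j else M.ε) M.≈ f i
  sum-indicator {r = suc r} zero f =
    M.trans (M.∙-congˡ (sum-replicate-zero r)) (M.identityʳ _)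
  sum-indicator (suc i) f =
    M.trans (M.identityˡ _) (sum-indicator i (f ∘ suc))

sum-const : ∀ r c → Σℕ.sum {r} (λ _ → c) ≡ r ℕ.* c
sum-const zero    c = refl
sum-const (suc r) c = cong (c ℕ.+_) (sum-const r c)

-- Equal remainders cancel from the two division equations, which leaves e as a difference of two
-- multiples of n. This is what makes negation move a class when n does not divide the logarithm of
-- -1.
%-cancel : ∀ n .{{_ : NonZero n}} e a → (e ℕ.+ a) % n ≡ a % n → n ∣ e
%-cancel n e a eq = ∣.∣m+n∣m⇒∣n {m = a ℕ./ n ℕ.* n}
  (divides ((e ℕ.+ a) ℕ./ n) (ℕ.+-cancelˡ-≡ (a % n) _ _ (begin
    a % n ℕ.+ (a ℕ./ n ℕ.* n ℕ.+ e)                 ≡⟨ ℕ.+-assoc (a % n) _ e ⟨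
    a % n ℕ.+ a ℕ./ n ℕ.* n ℕ.+ e                   ≡⟨ cong (ℕ._+ e) (m≡m%n+[m/n]*n a n) ⟨
    a ℕ.+ e                                         ≡⟨ ℕ.+-comm a e ⟩
    e ℕ.+ a                                         ≡⟨ m≡m%n+[m/n]*n (e ℕ.+ a) n ⟩
    (e ℕ.+ a) % n ℕ.+ (e ℕ.+ a) ℕ./ n ℕ.* n         ≡⟨ cong (ℕ._+ (e ℕ.+ a) ℕ./ n ℕ.* n) eq ⟩
    a % n ℕ.+ (e ℕ.+ a) ℕ./ n ℕ.* n                 ∎)))
  (∣.n∣m*n (a ℕ./ n))

funToFin-injective : ∀ {b b′ : Fin m → Fin r} → funToFin b ≡ funToFin b′ → ∀ i → b i ≡ b′ i
funToFin-injective {b = b} {b′} eq i = trans (sym (Fin.finToFun-funToFin b i))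
  (trans (cong (λ k → finToFun k i) eq) (Fin.finToFun-funToFin b′ i))

-- Polynomials as functionals on functions of the exponent

⟪_,_⟫ : Poly m → (Vec ℕ m → ℚ) → ℚ
⟪ []            , φ ⟫ = 0ℚ
⟪ ((c , d) ∷ f) , φ ⟫ = c ℚ.* φ d ℚ.+ ⟪ f , φ ⟫

⟪⟫-cong : ∀ (f : Poly m) {φ φ′} → (∀ d → φ d ≡ φ′ d) → ⟪ f , φ ⟫ ≡ ⟪ f , φ′ ⟫
⟪⟫-cong []            eq = refl
⟪⟫-cong ((c , d) ∷ f) eq = cong₂ (λ x y → c ℚ.* x ℚ.+ y) (eq d) (⟪⟫-cong f eq)

⟪⟫-+ : ∀ (f g : Poly m) φ → ⟪ f +ₚ g , φ ⟫ ≡ ⟪ f , φ ⟫ ℚ.+ ⟪ g , φ ⟫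
⟪⟫-+ []            g φ = sym (ℚ.+-identityˡ _)
⟪⟫-+ ((c , d) ∷ f) g φ =
  trans (cong (c ℚ.* φ d ℚ.+_) (⟪⟫-+ f g φ)) (sym (ℚ.+-assoc (c ℚ.* φ d) _ _))

⟪⟫-• : ∀ c (f : Poly m) φ → ⟪ c •ₚ f , φ ⟫ ≡ c ℚ.* ⟪ f , φ ⟫
⟪⟫-• c []            φ = sym (ℚ.*-zeroʳ c)
⟪⟫-• c ((b , d) ∷ f) φ = trans (cong (c ℚ.* b ℚ.* φ d ℚ.+_) (⟪⟫-• c f φ))
  (solve 4 (λ c b x y → c :* b :* x :+ c :* y := c :* (b :* x :+ y)) refl c b (φ d) ⟪ f , φ ⟫)

⟪⟫-neg : ∀ (f g : Poly m) φ → ⟪ f -ₚ g , φ ⟫ ≡ ⟪ f , φ ⟫ ℚ.- ⟪ g , φ ⟫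
⟪⟫-neg f g φ = trans (⟪⟫-+ f _ φ) (cong (⟪ f , φ ⟫ ℚ.+_)
  (trans (⟪⟫-• (ℚ.- 1ℚ) g φ) (solve 1 (λ x → (:- con 1ℚ) :* x := :- x) refl ⟪ g , φ ⟫)))

⟪⟫-const : ∀ c φ → ⟪ const {m} c , φ ⟫ ≡ c ℚ.* φ (Vec.replicate m 0)
⟪⟫-const c φ = ℚ.+-identityʳ _

⟪⟫-monomial : ∀ (e : Vec ℕ m) φ → ⟪ monomial e , φ ⟫ ≡ φ e
⟪⟫-monomial e φ = trans (ℚ.+-identityʳ _) (ℚ.*-identityˡ _)

-- The sum over pairs of terms is taken iteratively, the term of f being fixed first. In terms of
-- functionals this is convolution, with addition of exponents as the operation.
⟪⟫-* : ∀ (f g : Poly m) φ →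
       ⟪ f *ₚ g , φ ⟫ ≡ ⟪ f , (λ d → ⟪ g , (λ d′ → φ (Vec.zipWith ℕ._+_ d d′)) ⟫) ⟫
⟪⟫-* []            g φ = refl
⟪⟫-* ((c , d) ∷ f) g φ = trans (⟪⟫-+ (List.map _ g) _ φ) (cong₂ ℚ._+_ (term g) (⟪⟫-* f g φ))
  where
  term : ∀ g → ⟪ List.map (λ (c′ , d′) → c ℚ.* c′ , Vec.zipWith ℕ._+_ d d′) g , φ ⟫
             ≡ c ℚ.* ⟪ g , (λ d′ → φ (Vec.zipWith ℕ._+_ d d′)) ⟫
  term []              = sym (ℚ.*-zeroʳ c)
  term ((c′ , d′) ∷ g) = trans (cong (c ℚ.* c′ ℚ.* _ ℚ.+_) (term g))
    (solve 4 (λ c b x y → c :* b :* x :+ c :* y := c :* (b :* x :+ y)) refl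
      c c′ (φ (Vec.zipWith ℕ._+_ d d′)) _)

⟪⟫-∑ : ∀ (f : Fin r → Poly m) φ → ⟪ ∑ₚ f , φ ⟫ ≡ Σℚ.sum (λ i → ⟪ f i , φ ⟫)
⟪⟫-∑ {zero}  f φ = refl
⟪⟫-∑ {suc r} f φ = trans (⟪⟫-+ (f zero) _ φ) (cong (⟪ f zero , φ ⟫ ℚ.+_) (⟪⟫-∑ (f ∘ suc) φ))

-- Linearity in the test function, not in the polynomial: it lets an expansion of the inner factor
-- of a product be pulled out of the outer evaluation.
⟪⟫-linear : ∀ (f : Poly m) (b : Fin r → ℚ) (φ : Fin r → Vec ℕ m → ℚ) →
            ⟪ f , (λ d → Σℚ.sum (λ j → b j ℚ.* φ j d)) ⟫ ≡ Σℚ.sum (λ j → b j ℚ.* ⟪ f , φ j ⟫)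
⟪⟫-linear {r = r} [] b φ = sym (trans (Σℚ.sum-cong-≗ (λ j → ℚ.*-zeroʳ (b j))) (Σℚ.sum-replicate-zero r))
⟪⟫-linear ((c , d) ∷ f) b φ = begin
  c ℚ.* Σℚ.sum (λ j → b j ℚ.* φ j d) ℚ.+ ⟪ f , (λ d → Σℚ.sum (λ j → b j ℚ.* φ j d)) ⟫
    ≡⟨ cong₂ ℚ._+_ (Σℚ.*-distribˡ-sum c (λ j → b j ℚ.* φ j d)) (⟪⟫-linear f b φ) ⟩
  Σℚ.sum (λ j → c ℚ.* (b j ℚ.* φ j d)) ℚ.+ Σℚ.sum (λ j → b j ℚ.* ⟪ f , φ j ⟫)
    ≡⟨ Σℚ.∑-distrib-+ (λ j → c ℚ.* (b j ℚ.* φ j d)) (λ j → b j ℚ.* ⟪ f , φ j ⟫) ⟨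
  Σℚ.sum (λ j → c ℚ.* (b j ℚ.* φ j d) ℚ.+ b j ℚ.* ⟪ f , φ j ⟫)
    ≡⟨ Σℚ.sum-cong-≗ (λ j → solve 4 (λ c b x y → c :* (b :* x) :+ b :* y := b :* (c :* x :+ y)) refl
                                    c (b j) (φ j d) ⟪ f , φ j ⟫) ⟩
  Σℚ.sum (λ j → b j ℚ.* (c ℚ.* φ j d ℚ.+ ⟪ f , φ j ⟫)) ∎

-- Coefficients and functionals determine each other

_≟ᵥ_ : (d e : Vec ℕ m) → Dec (d ≡ e)
_≟ᵥ_ = Vec.≡-dec ℕ._≟_

coeff-⟪⟫ : ∀ (f : Poly m) e → coeff f e ≡ ⟪ f , (λ d → if does (d ≟ᵥ e) then 1ℚ else 0ℚ) ⟫
coeff-⟪⟫ []            e = refl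
coeff-⟪⟫ ((c , d) ∷ f) e with d ≟ᵥ e
... | yes _ = cong₂ ℚ._+_ (sym (ℚ.*-identityʳ c)) (coeff-⟪⟫ f e)
... | no  _ = trans (coeff-⟪⟫ f e) (sym (trans (cong (ℚ._+ _) (ℚ.*-zeroʳ c)) (ℚ.+-identityˡ _)))

⟪⟫⇒≈ₚ : ∀ (f g : Poly m) → (∀ φ → ⟪ f , φ ⟫ ≡ ⟪ g , φ ⟫) → f ≈ₚ g
⟪⟫⇒≈ₚ f g eq e = trans (coeff-⟪⟫ f e) (trans (eq _) (sym (coeff-⟪⟫ g e)))

module _ (e : Vec ℕ m) where
  off? : Decidable (λ (t : ℚ × Vec ℕ m) → ¬ proj₂ t ≡ e)
  off? t = ¬? (proj₂ t ≟ᵥ e)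

  ⟪⟫-split : ∀ (f : Poly m) φ → ⟪ f , φ ⟫ ≡ coeff f e ℚ.* φ e ℚ.+ ⟪ List.filter off? f , φ ⟫
  ⟪⟫-split []            φ = sym (trans (ℚ.+-identityʳ _) (ℚ.*-zeroˡ (φ e)))
  ⟪⟫-split ((c , d) ∷ f) φ with d ≟ᵥ e
  ... | yes refl = trans (cong (c ℚ.* φ d ℚ.+_) (⟪⟫-split f φ))
    (solve 4 (λ c x y z → c :* x :+ (y :* x :+ z) := (c :+ y) :* x :+ z) refl c (φ d) (coeff f d) _)
  ... | no  _    = trans (cong (c ℚ.* φ d ℚ.+_) (⟪⟫-split f φ))
    (solve 3 (λ x y z → x :+ (y :+ z) := y :+ (x :+ z)) refl (c ℚ.* φ d) (coeff f e ℚ.* φ e) _)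

  coeff-filter-off : ∀ (f : Poly m) → (∀ d → coeff f d ≡ 0ℚ) → ∀ d → coeff (List.filter off? f) d ≡ 0ℚ
  coeff-filter-off f f≈0 d with d ≟ᵥ e
  ... | yes refl = vanish f
    where
    vanish : ∀ f → coeff (List.filter off? f) e ≡ 0ℚ
    vanish []             = refl
    vanish ((c , d′) ∷ f) with d′ ≟ᵥ e in eq
    ... | yes _ = vanish f
    ... | no  _ rewrite eq = vanish f
  ... | no d≢e = trans (keep f) (f≈0 d)
    where
    keep : ∀ f → coeff (List.filter off? f) d ≡ coeff f d
    keep []             = refl
    keep ((c , d′) ∷ f) with d′ ≟ᵥ e
    ... | yes refl with d′ ≟ᵥ d
    ...   | yes refl = contradiction refl d≢e
    ...   | no _     = keep f
    keep ((c , d′) ∷ f) | no _ with d′ ≟ᵥ d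
    ...   | yes _ = cong (c ℚ.+_) (keep f)
    ...   | no _  = keep f

-- A list with zero coefficients need not be empty, since terms may cancel. All terms sharing the
-- exponent of the head are removed at once: together they contribute a coefficient, which is 0, and
-- the remaining list is shorter and still has zero coefficients. A filtered list is not a
-- structural part of f, hence the length bound `k`.
⟪⟫-zero : ∀ (f : Poly m) → (∀ e → coeff f e ≡ 0ℚ) → ∀ φ → ⟪ f , φ ⟫ ≡ 0ℚ
⟪⟫-zero f f≈0 φ = go (List.length f) f ℕ.≤-refl f≈0
  where
  go : ∀ k f → List.length f ℕ.≤ k → (∀ e → coeff f e ≡ 0ℚ) → ⟪ f , φ ⟫ ≡ 0ℚ
  go k       []              _         f≈0 = refl
  go (suc k) f@((c , d) ∷ g) (s≤s len) f≈0 = begin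
    ⟪ f , φ ⟫                                            ≡⟨ ⟪⟫-split d f φ ⟩
    coeff f d ℚ.* φ d ℚ.+ ⟪ List.filter (off? d) f , φ ⟫ ≡⟨ cong₂ (λ x y → x ℚ.* φ d ℚ.+ y) (f≈0 d) rest ⟩
    0ℚ ℚ.* φ d ℚ.+ 0ℚ                                    ≡⟨ trans (ℚ.+-identityʳ _) (ℚ.*-zeroˡ (φ d)) ⟩
    0ℚ                                                   ∎
    where
    drop-head : List.filter (off? d) f ≡ List.filter (off? d) g
    drop-head = List.filter-reject (off? d) (λ d≢d → d≢d refl)
    rest : ⟪ List.filter (off? d) f , φ ⟫ ≡ 0ℚ
    rest = go k (List.filter (off? d) f) (ℕ.≤-trans (ℕ.≤-reflexive (cong List.length drop-head))
                    (ℕ.≤-trans (List.length-filter (off? d) g) len))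
                  (coeff-filter-off d f f≈0)

≈ₚ⇒⟪⟫ : ∀ (f g : Poly m) → f ≈ₚ g → ∀ φ → ⟪ f , φ ⟫ ≡ ⟪ g , φ ⟫
≈ₚ⇒⟪⟫ f g f≈g φ = ≡.subst₂ _≡_ (add-back _ _) (ℚ.+-identityˡ _) (cong (ℚ._+ ⟪ g , φ ⟫)
  (trans (sym (⟪⟫-neg f g φ)) (⟪⟫-zero (f -ₚ g) (λ e →
    trans (coeff-⟪⟫ (f -ₚ g) e) (trans (⟪⟫-neg f g _)
      (trans (cong (ℚ._- _) (trans (sym (coeff-⟪⟫ f e)) (trans (f≈g e) (coeff-⟪⟫ g e)))) (ℚ.+-inverseʳ ⟪ g , _ ⟫)))) φ)))
  where
  add-back : ∀ x y → x ℚ.- y ℚ.+ y ≡ x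
  add-back = solve 2 (λ x y → x :+ :- y :+ y := x) refl

-- The ideal ⟨x₁ᵖ - 1,…,xₘᵖ - 1⟩

module Ideal (p m : ℕ) where

  pe : Fin m → Vec ℕ m
  pe i = Vec.replicate m 0 [ i ]≔ p

  -- The adjoint of multiplication by the i-th generator xᵢᵖ - 1.
  ∂ : Fin m → (Vec ℕ m → ℚ) → Vec ℕ m → ℚ
  ∂ i φ d = φ (Vec.zipWith ℕ._+_ d (pe i)) ℚ.- φ d

  ⟪⟫-xᵖ-1 : ∀ i φ → ⟪ xᵖ-1 p m i , φ ⟫ ≡ φ (pe i) ℚ.- φ (Vec.replicate m 0)
  ⟪⟫-xᵖ-1 i φ = trans (⟪⟫-neg (monomial (pe i)) 1ₚ φ)
    (cong₂ ℚ._-_ (⟪⟫-monomial (pe i) φ) (⟪⟫-monomial (Vec.replicate m 0) φ))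

  ⟪⟫-multiple : ∀ (h : Poly m) i φ → ⟪ h *ₚ xᵖ-1 p m i , φ ⟫ ≡ ⟪ h , ∂ i φ ⟫
  ⟪⟫-multiple h i φ = trans (⟪⟫-* h (xᵖ-1 p m i) φ) (⟪⟫-cong h λ d →
    trans (⟪⟫-xᵖ-1 i (λ d′ → φ (Vec.zipWith ℕ._+_ d d′)))
      (cong (λ e → φ (Vec.zipWith ℕ._+_ d (pe i)) ℚ.- φ e) (Vec.zipWith-identityʳ {f = ℕ._+_} ℕ.+-identityʳ d)))

  combination : (Fin m → Poly m) → (Vec ℕ m → ℚ) → ℚ
  combination h φ = Σℚ.sum (λ i → ⟪ h i , ∂ i φ ⟫)

  infix 4 _∼_

  -- Congruence modulo the ideal with the cofactors `h` kept in view. Tested on functionals,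
  -- transitivity and symmetry become additive identities in ℚ instead of manipulations of lists.
  _∼_ : Poly m → Poly m → Set
  f ∼ g = Σ[ h ∈ (Fin m → Poly m) ] (∀ φ → ⟪ f , φ ⟫ ≡ combination h φ ℚ.+ ⟪ g , φ ⟫)

  ∼⇒mod : ∀ f g → f ∼ g → f ≡ g mod[x^ p -1]
  ∼⇒mod f g (h , eq) = h , ⟪⟫⇒≈ₚ (f -ₚ g) (∑ₚ (λ i → h i *ₚ xᵖ-1 p m i)) λ φ → begin
    ⟪ f -ₚ g , φ ⟫                                      ≡⟨ ⟪⟫-neg f g φ ⟩
    ⟪ f , φ ⟫ ℚ.- ⟪ g , φ ⟫                             ≡⟨ cong (ℚ._- ⟪ g , φ ⟫) (eq φ) ⟩
    combination h φ ℚ.+ ⟪ g , φ ⟫ ℚ.- ⟪ g , φ ⟫         ≡⟨ solve 2 (λ x y → x :+ y :+ :- y := x) refl _ ⟪ g , φ ⟫ ⟩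
    combination h φ                                     ≡⟨ Σℚ.sum-cong-≗ (λ i → ⟪⟫-multiple (h i) i φ) ⟨
    Σℚ.sum (λ i → ⟪ h i *ₚ xᵖ-1 p m i , φ ⟫)            ≡⟨ ⟪⟫-∑ (λ i → h i *ₚ xᵖ-1 p m i) φ ⟨
    ⟪ ∑ₚ (λ i → h i *ₚ xᵖ-1 p m i) , φ ⟫                ∎

  -- A periodic φ satisfies ∂ᵢφ = 0 for every i, so its functional kills every multiple of a
  -- generator.
  mod⇒⟪⟫ : ∀ f g → f ≡ g mod[x^ p -1] →
           ∀ φ → (∀ i d → φ (Vec.zipWith ℕ._+_ d (pe i)) ≡ φ d) → ⟪ f , φ ⟫ ≡ ⟪ g , φ ⟫
  mod⇒⟪⟫ f g (h , eq) φ periodic = begin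
    ⟪ f , φ ⟫                                      ≡⟨ solve 2 (λ x y → x := x :+ :- y :+ y) refl ⟪ f , φ ⟫ ⟪ g , φ ⟫ ⟩
    ⟪ f , φ ⟫ ℚ.- ⟪ g , φ ⟫ ℚ.+ ⟪ g , φ ⟫          ≡⟨ cong (ℚ._+ ⟪ g , φ ⟫) difference ⟩
    0ℚ ℚ.+ ⟪ g , φ ⟫                               ≡⟨ ℚ.+-identityˡ _ ⟩
    ⟪ g , φ ⟫                                      ∎
    where
    ⟪⟫-0 : ∀ (h : Poly m) → ⟪ h , (λ _ → 0ℚ) ⟫ ≡ 0ℚ
    ⟪⟫-0 []            = refl
    ⟪⟫-0 ((c , d) ∷ h) = trans (cong₂ ℚ._+_ (ℚ.*-zeroʳ c) (⟪⟫-0 h)) (ℚ.+-identityˡ 0ℚ)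

    difference : ⟪ f , φ ⟫ ℚ.- ⟪ g , φ ⟫ ≡ 0ℚ
    difference = begin
      ⟪ f , φ ⟫ ℚ.- ⟪ g , φ ⟫                  ≡⟨ ⟪⟫-neg f g φ ⟨
      ⟪ f -ₚ g , φ ⟫                           ≡⟨ ≈ₚ⇒⟪⟫ (f -ₚ g) (∑ₚ (λ i → h i *ₚ xᵖ-1 p m i)) eq φ ⟩
      ⟪ ∑ₚ (λ i → h i *ₚ xᵖ-1 p m i) , φ ⟫     ≡⟨ ⟪⟫-∑ (λ i → h i *ₚ xᵖ-1 p m i) φ ⟩
      Σℚ.sum (λ i → ⟪ h i *ₚ xᵖ-1 p m i , φ ⟫) ≡⟨ Σℚ.sum-cong-≗ (λ i → trans (⟪⟫-multiple (h i) i φ)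
                                                    (trans (⟪⟫-cong (h i) (λ d → trans (cong (ℚ._- φ d) (periodic i d)) (ℚ.+-inverseʳ (φ d)))) (⟪⟫-0 (h i)))) ⟩
      Σℚ.sum {m} (λ i → 0ℚ)                    ≡⟨ Σℚ.sum-replicate-zero m ⟩
      0ℚ                                       ∎

  combination-+ : ∀ h h′ φ → combination (λ i → h i +ₚ h′ i) φ ≡ combination h φ ℚ.+ combination h′ φ
  combination-+ h h′ φ = trans (Σℚ.sum-cong-≗ (λ i → ⟪⟫-+ (h i) (h′ i) (∂ i φ))) (Σℚ.∑-distrib-+ (λ i → ⟪ h i , ∂ i φ ⟫) _)

  combination-• : ∀ c h φ → combination (λ i → c •ₚ h i) φ ≡ c ℚ.* combination h φ
  combination-• c h φ = trans (Σℚ.sum-cong-≗ (λ i → ⟪⟫-• c (h i) (∂ i φ))) (sym (Σℚ.*-distribˡ-sum c (λ i → ⟪ h i , ∂ i φ ⟫)))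

  ∼-reflexive : ∀ f g → (∀ φ → ⟪ f , φ ⟫ ≡ ⟪ g , φ ⟫) → f ∼ g
  ∼-reflexive f g eq = (λ _ → []) , λ φ →
    trans (eq φ) (sym (trans (cong (ℚ._+ ⟪ g , φ ⟫) (Σℚ.sum-replicate-zero m)) (ℚ.+-identityˡ ⟪ g , φ ⟫)))

  ∼-trans : ∀ {f g k} → f ∼ g → g ∼ k → f ∼ k
  ∼-trans (h , eq) (h′ , eq′) = (λ i → h i +ₚ h′ i) , λ φ → trans (eq φ)
    (trans (cong (combination h φ ℚ.+_) (eq′ φ))
      (trans (sym (ℚ.+-assoc (combination h φ) _ _)) (cong (ℚ._+ _) (sym (combination-+ h h′ φ)))))

  ∼-sym : ∀ {f g} → f ∼ g → g ∼ f
  ∼-sym {f} {g} (h , eq) = (λ i → (ℚ.- 1ℚ) •ₚ h i) , λ φ → sym (begin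
    combination (λ i → (ℚ.- 1ℚ) •ₚ h i) φ ℚ.+ ⟪ f , φ ⟫              ≡⟨ cong₂ ℚ._+_ (combination-• (ℚ.- 1ℚ) h φ) (eq φ) ⟩
    (ℚ.- 1ℚ) ℚ.* combination h φ ℚ.+ (combination h φ ℚ.+ ⟪ g , φ ⟫)  ≡⟨ solve 2 (λ x y → (:- con 1ℚ) :* x :+ (x :+ y) := y) refl (combination h φ) ⟪ g , φ ⟫ ⟩
    ⟪ g , φ ⟫                                                        ∎)

  ∼-∷ : ∀ c {d e f g} → monomial d ∼ monomial e → f ∼ g → ((c , d) ∷ f) ∼ ((c , e) ∷ g)
  ∼-∷ c {d} {e} {f} {g} (h , eq) (h′ , eq′) = (λ i → c •ₚ h i +ₚ h′ i) , λ φ → begin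
    c ℚ.* φ d ℚ.+ ⟪ f , φ ⟫                                                          ≡⟨ cong₂ (λ x y → c ℚ.* x ℚ.+ y) (value-eq φ) (eq′ φ) ⟩
    c ℚ.* (combination h φ ℚ.+ φ e) ℚ.+ (combination h′ φ ℚ.+ ⟪ g , φ ⟫)              ≡⟨ solve 5 (λ c x y z w → c :* (x :+ y) :+ (z :+ w) := c :* x :+ z :+ (c :* y :+ w)) refl c (combination h φ) (φ e) (combination h′ φ) ⟪ g , φ ⟫ ⟩
    c ℚ.* combination h φ ℚ.+ combination h′ φ ℚ.+ (c ℚ.* φ e ℚ.+ ⟪ g , φ ⟫)          ≡⟨ cong (λ x → x ℚ.+ combination h′ φ ℚ.+ (c ℚ.* φ e ℚ.+ ⟪ g , φ ⟫)) (combination-• c h φ) ⟨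
    combination (λ i → c •ₚ h i) φ ℚ.+ combination h′ φ ℚ.+ (c ℚ.* φ e ℚ.+ ⟪ g , φ ⟫) ≡⟨ cong (ℚ._+ (c ℚ.* φ e ℚ.+ ⟪ g , φ ⟫)) (combination-+ (λ i → c •ₚ h i) h′ φ) ⟨
    combination (λ i → c •ₚ h i +ₚ h′ i) φ ℚ.+ (c ℚ.* φ e ℚ.+ ⟪ g , φ ⟫)              ∎
    where
    value-eq : ∀ φ → φ d ≡ combination h φ ℚ.+ φ e
    value-eq φ = trans (sym (⟪⟫-monomial d φ)) (trans (eq φ) (cong (combination h φ ℚ.+_) (⟪⟫-monomial e φ)))

  monomial-step : ∀ i d → monomial (Vec.zipWith ℕ._+_ d (pe i)) ∼ monomial d
  monomial-step i d = h , λ φ → begin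
    ⟪ monomial (Vec.zipWith ℕ._+_ d (pe i)) , φ ⟫ ≡⟨ ⟪⟫-monomial _ φ ⟩
    φ (Vec.zipWith ℕ._+_ d (pe i))                ≡⟨ solve 2 (λ x y → x := x :+ :- y :+ y) refl _ (φ d) ⟩
    ∂ i φ d ℚ.+ φ d                               ≡⟨ cong₂ ℚ._+_ (sum-indicator ℚ.+-0-commutativeMonoid i (λ j → ∂ j φ d)) (⟪⟫-monomial d φ) ⟨
    Σℚ.sum (λ j → if does (i Fin.≟ j) then ∂ j φ d else 0ℚ) ℚ.+ ⟪ monomial d , φ ⟫
      ≡⟨ cong (ℚ._+ ⟪ monomial d , φ ⟫) (Σℚ.sum-cong-≗ (λ j → term j φ)) ⟨
    combination h φ ℚ.+ ⟪ monomial d , φ ⟫        ∎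
    where
    -- Since x^d xᵢᵖ - x^d is x^d times the i-th generator, the only nonzero cofactor is x^d.
    h : Fin m → Poly m
    h j = if does (i Fin.≟ j) then monomial d else []
    term : ∀ j φ → ⟪ h j , ∂ j φ ⟫ ≡ (if does (i Fin.≟ j) then ∂ j φ d else 0ℚ)
    term j φ with does (i Fin.≟ j)
    ... | true  = ⟪⟫-monomial d (∂ j φ)
    ... | false = refl

-- An induction principle for preorders, used both for equality of field values and for congruence
-- modulo the ideal. The head coordinate is lowered by p as often as possible; the tail is then
-- treated with the head frozen at its remainder.
reduce-exponents : ∀ (p : ℕ) .{{_ : NonZero p}} m {ℓ} (R : Vec ℕ m → Vec ℕ m → Set ℓ) →
  (∀ {d} → R d d) → (∀ {d e f} → R d e → R e f → R d f) →
  (∀ i d → R (Vec.zipWith ℕ._+_ d (Vec.replicate m 0 [ i ]≔ p)) d) →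
  ∀ d → R d (Vec.map (_% p) d)
reduce-exponents p zero    R rfl tr step []      = rfl
reduce-exponents p (suc m) R rfl tr step (x ∷ d) = tr
  (≡.subst (λ y → R (y ∷ d) (x % p ∷ d)) (sym (m≡m%n+[m/n]*n x p)) (lower (x ℕ./ p)))
  (reduce-exponents p m (λ d e → R (x % p ∷ d) (x % p ∷ e)) rfl tr
    -- A step in a later coordinate adds 0 to the head, which has to be removed by a rewriting.
    (λ i d → ≡.subst (λ y → R (y ∷ _) (x % p ∷ d)) (ℕ.+-identityʳ (x % p)) (step (suc i) (x % p ∷ d))) d)
  where
  lower : ∀ k → R (x % p ℕ.+ k ℕ.* p ∷ d) (x % p ∷ d)
  lower zero    = ≡.subst (λ y → R (y ∷ d) (x % p ∷ d)) (sym (ℕ.+-identityʳ (x % p))) rfl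
  lower (suc k) = tr (≡.subst₂ (λ y e → R (y ∷ e) (x % p ℕ.+ k ℕ.* p ∷ d))
    (trans (ℕ.+-assoc (x % p) _ p) (cong (x % p ℕ.+_) (ℕ.+-comm (k ℕ.* p) p)))
    (Vec.zipWith-identityʳ {f = ℕ._+_} ℕ.+-identityʳ d)
    (step zero (x % p ℕ.+ k ℕ.* p ∷ d))) (lower k)

-- Natural numbers and indicators as rationals

ι : ℕ → ℚ
ι k = + k / 1

-- Fractions in ℚ are normalised, which blocks computation on variables; among unnormalised
-- fractions with denominator 1 the claim is an identity of integers.
ι-+ : ∀ a b → ι (a ℕ.+ b) ≡ ι a ℚ.+ ι b
ι-+ a b = ℚ.toℚᵘ-injective (ℚᵘ.≃-trans (ℚ.toℚᵘ-fromℚᵘ (mkℚᵘ (+ (a ℕ.+ b)) 0))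
  (ℚᵘ.≃-trans (*≡* {q = mkℚᵘ (+ a) 0 ℚᵘ.+ mkℚᵘ (+ b) 0} (cong (ℤ._* + 1) (sym (cong₂ ℤ._+_ (ℤ.*-identityʳ (+ a)) (ℤ.*-identityʳ (+ b))))))
  (ℚᵘ.≃-sym (ℚᵘ.≃-trans (ℚ.toℚᵘ-homo-+ (ι a) (ι b))
    (ℚᵘ.+-cong (ℚ.toℚᵘ-fromℚᵘ (mkℚᵘ (+ a) 0)) (ℚ.toℚᵘ-fromℚᵘ (mkℚᵘ (+ b) 0)))))))

ι-sum : ∀ (f : Fin r → ℕ) → ι (Σℕ.sum f) ≡ Σℚ.sum (ι ∘ f)
ι-sum {zero}  f = refl
ι-sum {suc r} f = trans (ι-+ (f zero) _) (cong (ι (f zero) ℚ.+_) (ι-sum (f ∘ suc)))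

ind : Bool → ℕ
ind b = if b then 1 else 0

ι-ind-* : ∀ b k → ι (ind b ℕ.* k) ≡ ι (ind b) ℚ.* ι k
ι-ind-* true  k = trans (cong ι (ℕ.+-identityʳ k)) (sym (ℚ.*-identityˡ (ι k)))
ι-ind-* false k = sym (ℚ.*-zeroˡ (ι k))

ind-if : ∀ b x → (if b then x else 0ℚ) ≡ ι (ind b) ℚ.* x
ind-if true  x = sym (ℚ.*-identityˡ x)
ind-if false x = sym (ℚ.*-zeroˡ x)

-- R as the group algebra of the additive group of the field

module GroupAlgebra {a ℓ} {F : CommutativeRing a ℓ} {p m : ℕ} (pr : Prime p)
  (isFF : IsFiniteField F (p ℕ.^ m)) {γ : CommutativeRing.Carrier F} (prim : IsPrimitive isFF γ) where

  open CommutativeRing F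
    using (Carrier; _≈_; _+_; _*_; 0#; semiring; reflexive)
    renaming (refl to ≈-refl; sym to ≈-sym; trans to ≈-trans)
  private module F = CommutativeRing F
  open IsFiniteField isFF
  open Inverse enumeration using (to; from; to-cong; strictlyInverseˡ; strictlyInverseʳ)
  open Exponentiation semiring
  open Multiplication semiring using (×-homo-+) renaming (_×_ to _×ₙ_)
  open Summation semiring
  open PrimitiveElement {m = m} pr isFF prim
  open Ideal p m using (_∼_; ∼⇒mod; mod⇒⟪⟫; ∼-reflexive; ∼-trans; ∼-sym; ∼-∷; monomial-step; pe)

  Congruent : (Carrier → ℚ) → Set _
  Congruent Φ = ∀ {x y} → x ≈ y → Φ x ≡ Φ y

  -- `value` with unbounded exponents in place of digits: a homomorphism from exponent vectors to
  -- the additive group, defined before any reduction modulo p.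
  ψ : Vec ℕ m → Carrier
  ψ d = ∑[ i < m ] (Vec.lookup d i ×ₙ γ ^ toℕ i)

  ψ-+ : ∀ d e → ψ (Vec.zipWith ℕ._+_ d e) ≈ ψ d + ψ e
  ψ-+ d e = ≈-trans (sum-cong-≋ (λ i → ≈-trans
      (reflexive (cong (_×ₙ γ ^ toℕ i) (Vec.lookup-zipWith ℕ._+_ i d e)))
      (×-homo-+ (γ ^ toℕ i) (Vec.lookup d i) (Vec.lookup e i))))
    (∑-distrib-+ (λ i → Vec.lookup d i ×ₙ γ ^ toℕ i) _)

  ψ-0 : ψ (Vec.replicate m 0) ≈ 0#
  ψ-0 = ≈-trans (sum-cong-≋ {m} (λ i → reflexive (cong (_×ₙ γ ^ toℕ i) (Vec.lookup-replicate i 0))))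
    (sum-replicate-zero m)

  ψ-pe : ∀ i → ψ (pe i) ≈ 0#
  ψ-pe i = ≈-trans (sum-cong-≋ term) (sum-replicate-zero m)
    where
    term : ∀ j → Vec.lookup (pe i) j ×ₙ γ ^ toℕ j ≈ 0#
    term j with j Fin.≟ i
    ... | yes refl = ≈-trans (reflexive (cong (_×ₙ γ ^ toℕ j) (Vec.lookup∘updateAt j (Vec.replicate m 0)))) (p×≈0 _)
    ... | no  j≢i  = reflexive (cong (_×ₙ γ ^ toℕ j)
      (trans (Vec.lookup∘updateAt′ j i j≢i (Vec.replicate m 0)) (Vec.lookup-replicate j 0)))

  ψ-periodic : ∀ i d → ψ (Vec.zipWith ℕ._+_ d (pe i)) ≈ ψ d
  ψ-periodic i d = ≈-trans (ψ-+ d (pe i)) (≈-trans (F.+-congˡ (ψ-pe i)) (F.+-identityʳ (ψ d)))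

  ψ-% : ∀ d → ψ d ≈ ψ (Vec.map (_% p) d)
  ψ-% = reduce-exponents p m (λ d e → ψ d ≈ ψ e) ≈-refl ≈-trans ψ-periodic

  ψ-tabulate : ∀ b → ψ (Vec.tabulate (toℕ ∘ b)) ≈ value b
  ψ-tabulate b = sum-cong-≋ (λ i → reflexive (cong (_×ₙ γ ^ toℕ i) (Vec.lookup∘tabulate (toℕ ∘ b) i)))

  value-cong : ∀ {b b′} → (∀ i → b i ≡ b′ i) → value b ≈ value b′
  value-cong eq = sum-cong-≋ (λ i → reflexive (cong (λ k → toℕ k ×ₙ γ ^ toℕ i) (eq i)))

  -- digits is not known to respect _≈_, so it is precomposed with a choice of representatives.
  canonical : Carrier → Fin m → Fin p
  canonical x = digits (from (to x))

  value-digits : ∀ i → from i ≈ value (digits (from i))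
  value-digits i = proj₂ (representation (from i))

  -- Uniqueness of digits by counting. The vector `b` and the digit vectors of all N elements are N
  -- + 1 vectors among N, so two coincide. Two elements with equal digits would be equal, hence `b`
  -- is the digit vector of some element, and that element is `value b`.
  canonical-value : ∀ b i → b i ≡ canonical (value b) i
  canonical-value b = let i , j , i<j , eq = Fin.pigeonhole (ℕ.n<1+n N) holes in cases i j i<j eq
    where
    holes : Fin (suc N) → Fin N
    holes zero    = funToFin b
    holes (suc i) = funToFin (digits (from i))

    cases : ∀ i j → i Fin.< j → holes i ≡ holes j → ∀ l → b l ≡ canonical (value b) l
    cases zero    (suc j) i<j eq l = trans (b≗ l) (cong (λ k → digits (from k) l) (sym to≡j))
      where
      b≗ : ∀ l → b l ≡ digits (from j) l
      b≗ = funToFin-injective eq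
      to≡j : to (value b) ≡ j
      to≡j = trans (to-cong (≈-trans (value-cong b≗) (≈-sym (value-digits j)))) (strictlyInverseˡ j)
    cases (suc i) (suc j) i<j eq = contradiction (cong (toℕ ∘ suc) i≡j) (ℕ.<⇒≢ i<j)
      where
      i≡j : i ≡ j
      i≡j = trans (sym (strictlyInverseˡ i)) (trans (to-cong (≈-trans (value-digits i)
        (≈-trans (value-cong (funToFin-injective eq)) (≈-sym (value-digits j))))) (strictlyInverseˡ j))

  canonicalVec : Carrier → Vec ℕ m
  canonicalVec x = Vec.tabulate (toℕ ∘ canonical x)

  canonicalVec-cong : ∀ {x y} → x ≈ y → canonicalVec x ≡ canonicalVec y
  canonicalVec-cong x≈y = cong (λ k → Vec.tabulate (toℕ ∘ digits (from k))) (to-cong x≈y)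

  -- A reduced exponent vector is recovered from its field element alone; this is the injectivity of
  -- the map from R to the group algebra.
  %-canonical : ∀ d → Vec.map (_% p) d ≡ canonicalVec (ψ d)
  %-canonical d = trans d%p≡ (trans (Vec.tabulate-cong (cong toℕ ∘ canonical-value b)) (canonicalVec-cong value≈))
    where
    b : Fin m → Fin p
    b i = fromℕ< (m%n<n (Vec.lookup d i) p)
    d%p≡ : Vec.map (_% p) d ≡ Vec.tabulate (toℕ ∘ b)
    d%p≡ = trans (sym (Vec.tabulate∘lookup _)) (Vec.tabulate-cong (λ i →
      trans (Vec.lookup-map i (_% p) d) (sym (Fin.toℕ-fromℕ< (m%n<n (Vec.lookup d i) p)))))
    value≈ : value b ≈ ψ d
    value≈ = ≈-trans (≈-sym (ψ-tabulate b)) (≈-trans (reflexive (cong ψ (sym d%p≡))) (≈-sym (ψ-% d)))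

  E : Poly m → (Carrier → ℚ) → ℚ
  E f Φ = ⟪ f , Φ ∘ ψ ⟫

  E-cong : ∀ f {Φ Φ′} → (∀ x → Φ x ≡ Φ′ x) → E f Φ ≡ E f Φ′
  E-cong f eq = ⟪⟫-cong f (eq ∘ ψ)

  infix 4 _≋_

  _≋_ : Poly m → Poly m → Set _
  f ≋ g = ∀ Φ → Congruent Φ → E f Φ ≡ E g Φ

  mod⇒≋ : ∀ f g → f ≡ g mod[x^ p -1] → f ≋ g
  mod⇒≋ f g eq Φ Φ-cong = mod⇒⟪⟫ f g eq (Φ ∘ ψ) (λ i d → Φ-cong (ψ-periodic i d))

  reduced : Poly m → Poly m
  reduced = List.map (λ (c , d) → c , Vec.map (_% p) d)

  ∼-reduced : ∀ f → f ∼ reduced f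
  ∼-reduced []            = ∼-reflexive [] [] (λ _ → refl)
  ∼-reduced ((c , d) ∷ f) = ∼-∷ c {f = f} {reduced f}
    (reduce-exponents p m (λ d e → monomial d ∼ monomial e)
      (λ {d} → ∼-reflexive (monomial d) (monomial d) (λ _ → refl))
      (λ {d} {e} {f} → ∼-trans {monomial d} {monomial e} {monomial f}) monomial-step d)
    (∼-reduced f)

  ⟪⟫-reduced : ∀ f φ → ⟪ reduced f , φ ⟫ ≡ E f (φ ∘ canonicalVec)
  ⟪⟫-reduced []            φ = refl
  ⟪⟫-reduced ((c , d) ∷ f) φ = cong₂ (λ e x → c ℚ.* φ e ℚ.+ x) (%-canonical d) (⟪⟫-reduced f φ)

  -- After reduction only canonical exponent vectors remain, so an arbitrary test function φ on
  -- exponents acts as `φ ∘ canonicalVec`, a function on the field that respects equality. The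
  -- hypothesis therefore covers every φ.
  ≋⇒mod : ∀ f g → f ≋ g → f ≡ g mod[x^ p -1]
  ≋⇒mod f g f≋g = ∼⇒mod f g (∼-trans {f} {reduced f} {g} (∼-reduced f)
    (∼-trans {reduced f} {reduced g} {g} (∼-reflexive (reduced f) (reduced g) reduced≈)
      (∼-sym {g} {reduced g} (∼-reduced g))))
    where
    reduced≈ : ∀ φ → ⟪ reduced f , φ ⟫ ≡ ⟪ reduced g , φ ⟫
    reduced≈ φ = trans (⟪⟫-reduced f φ)
      (trans (f≋g _ (λ x≈y → cong φ (canonicalVec-cong x≈y))) (sym (⟪⟫-reduced g φ)))

  translate-congruent : ∀ {Φ} g → Congruent Φ → Congruent (λ x → E g (λ y → Φ (x + y)))
  translate-congruent g Φ-cong x≈y = E-cong g (λ z → Φ-cong (F.+-congʳ {z} x≈y))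

  E-* : ∀ f g Φ → Congruent Φ → E (f *ₚ g) Φ ≡ E f (λ x → E g (λ y → Φ (x + y)))
  E-* f g Φ Φ-cong = trans (⟪⟫-* f g (Φ ∘ ψ)) (⟪⟫-cong f (λ d → ⟪⟫-cong g (λ e → Φ-cong (ψ-+ d e))))

  E-charPoly : ∀ {b} {A : Pred Carrier b} (A? : Decidable A) Φ → Congruent Φ →
    E (charPoly A?) Φ ≡ Σℚ.sum (λ i → if does (A? (from i)) then Φ (from i) else 0ℚ)
  E-charPoly A? Φ Φ-cong = go from
    where
    -- The enumeration is generalised to any `g`, since the induction passes to `g ∘ suc`.
    go : ∀ {k} (g : Fin k → Carrier) →
      E (sumₚ (List.map (λ β → monomial (Vec.tabulate (toℕ ∘ digits β))) (List.filter A? (List.tabulate g)))) Φ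
        ≡ Σℚ.sum (λ i → if does (A? (g i)) then Φ (g i) else 0ℚ)
    go {zero}  g = refl
    go {suc k} g with does (A? (g zero))
    ... | true  = cong₂ ℚ._+_ (trans (ℚ.*-identityˡ _)
                    (Φ-cong (≈-trans (ψ-tabulate _) (≈-sym (proj₂ (representation (g zero))))))) (go (g ∘ suc))
    ... | false = trans (go (g ∘ suc)) (sym (ℚ.+-identityˡ _))

  module _ (σ τ : Carrier → Carrier) (σ-cong : ∀ {x y} → x ≈ y → σ x ≈ σ y) (τ-cong : ∀ {x y} → x ≈ y → τ x ≈ τ y)
    (στ : ∀ x → σ (τ x) ≈ x) (τσ : ∀ x → τ (σ x) ≈ x) where

    permute : Perm.Permutation N N
    permute = Perm.permutation (to ∘ σ ∘ from) (to ∘ τ ∘ from)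
      (λ i → trans (to-cong (≈-trans (σ-cong (strictlyInverseʳ _)) (στ _))) (strictlyInverseˡ i))
      (λ i → trans (to-cong (≈-trans (τ-cong (strictlyInverseʳ _)) (τσ _))) (strictlyInverseˡ i))

    module _ {c ℓ} (M : CommutativeMonoid c ℓ) where
      private module M = CommutativeMonoid M
      open CommutativeMonoidSum M using () renaming (sum to sumᴹ; sum-permute to sumᴹ-permute; sum-cong-≋ to sumᴹ-cong)

      sum-substitute : (Φ : Carrier → M.Carrier) → (∀ {x y} → x ≈ y → Φ x M.≈ Φ y) →
                       sumᴹ (Φ ∘ from) M.≈ sumᴹ (Φ ∘ σ ∘ from)
      sum-substitute Φ Φ-cong = M.trans (sumᴹ-permute (Φ ∘ from) permute)
        (sumᴹ-cong (λ i → Φ-cong (strictlyInverseʳ (σ (from i)))))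

-- The discrete logarithm

module DiscreteLogarithm {a ℓ} {F : CommutativeRing a ℓ} {p m : ℕ} (pr : Prime p)
  (isFF : IsFiniteField F (p ℕ.^ m)) {γ : CommutativeRing.Carrier F} (prim : IsPrimitive isFF γ) where

  open CommutativeRing F
    using (Carrier; _≈_; _*_; 0#; 1#; setoid; semiring; reflexive)
    renaming (refl to ≈-refl; sym to ≈-sym; trans to ≈-trans)
  private module F = CommutativeRing F
  open IsFiniteField isFF
  open IsPrimitive prim
  open Inverse enumeration using (to; from; to-cong; strictlyInverseˡ; strictlyInverseʳ)
  open Exponentiation semiring
  open PrimitiveElement {m = m} pr isFF prim
  private module S = SetoidReasoning setoid

  logarithm : ∀ x → ¬ x ≈ 0# → ∃[ k ] x ≈ γ ^ k
  -- For n = 1, `natural-exponent` just replaces an integer exponent by a natural one.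
  logarithm x x≉0 = let t , x≈ = generates x x≉0 ; k , eq = Cyclotomic.natural-exponent 1 t in
    1 ℕ.* k , ≈-trans x≈ (≈-trans (reflexive (cong (powℤ γ γ≉0) (sym (ℤ.*-identityˡ t)))) eq)

  power-view : ∀ x → x ≈ 0# ⊎ ∃[ k ] x ≈ γ ^ k
  power-view x with x ≈? 0#
  ... | yes x≈0 = inj₁ x≈0
  ... | no  x≉0 = inj₂ (logarithm x x≉0)

  γ^-cancel : ∀ k {x y} → γ ^ k * x ≈ γ ^ k * y → x ≈ y
  γ^-cancel k {x} {y} eq = ≈-trans (≈-sym (^-inv δγ≈1 k x)) (≈-trans (F.*-congˡ eq) (^-inv δγ≈1 k y))

  γ^≉0 : ∀ k → ¬ γ ^ k ≈ 0#
  γ^≉0 k eq = 0≉1 (γ^-cancel k (≈-trans (F.zeroʳ _) (≈-trans (≈-sym eq) (≈-sym (F.*-identityʳ _)))))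

  γ^-+-cancel : ∀ a c → γ ^ (a ℕ.+ c) ≈ γ ^ a → γ ^ c ≈ 1#
  γ^-+-cancel a c eq = γ^-cancel a (≈-trans (≈-sym (^-homo-* γ a c)) (≈-trans eq (≈-sym (F.*-identityʳ _))))

  ^-multiple : ∀ {k} → γ ^ k ≈ 1# → ∀ t → γ ^ (t ℕ.* k) ≈ 1#
  ^-multiple {k} eq t = ≈-trans (reflexive (cong (γ ^_) (ℕ.*-comm t k)))
    (≈-trans (≈-sym (^-assocʳ γ k t)) (≈-trans (^-congˡ t eq) (1^ t)))

  ^-% : ∀ {k} .{{_ : NonZero k}} → γ ^ k ≈ 1# → ∀ t → γ ^ t ≈ γ ^ (t % k)
  ^-% {k} eq t = ≈-trans (reflexive (cong (γ ^_) (m≡m%n+[m/n]*n t k)))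
    (≈-trans (^-homo-* γ (t % k) _) (≈-trans (F.*-congˡ (^-multiple eq (t ℕ./ k))) (F.*-identityʳ _)))

  -- With period k + 1 the field consists of 0 and at most k + 1 powers of γ, so it injects into k +
  -- 2 indices.
  period-≥ : ∀ k → γ ^ suc k ≈ 1# → N ℕ.≤ suc (suc k)
  period-≥ k eq = Fin.injective⇒≤ {f = index} index-injective
    where
    -- The view is an argument, so that injectivity can be proved by matching on the views of both
    -- elements.
    index′ : ∀ x → x ≈ 0# ⊎ (∃[ a ] x ≈ γ ^ a) → Fin (suc (suc k))
    index′ x (inj₁ _)       = zero
    index′ x (inj₂ (a , _)) = suc (a mod suc k)

    index : Fin N → Fin (suc (suc k))
    index i = index′ (from i) (power-view (from i))

    index′-injective : ∀ x y v w → index′ x v ≡ index′ y w → x ≈ y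
    index′-injective x y (inj₁ x≈0)      (inj₁ y≈0)      _    = ≈-trans x≈0 (≈-sym y≈0)
    index′-injective x y (inj₂ (a , x≈)) (inj₂ (b , y≈)) same = S.begin
      x                     S.≈⟨ ≈-trans x≈ (^-% eq a) ⟩
      γ ^ (a % suc k)       S.≡⟨ cong (γ ^_) (Fin.toℕ-fromℕ< (m%n<n a (suc k))) ⟨
      γ ^ toℕ (a mod suc k) S.≡⟨ cong (λ i → γ ^ toℕ i) (Fin.suc-injective same) ⟩
      γ ^ toℕ (b mod suc k) S.≡⟨ cong (γ ^_) (Fin.toℕ-fromℕ< (m%n<n b (suc k))) ⟩
      γ ^ (b % suc k)       S.≈⟨ ≈-trans y≈ (^-% eq b) ⟨
      y                     S.∎

    index-injective : ∀ {i j} → index i ≡ index j → i ≡ j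
    index-injective {i} {j} same = trans (sym (strictlyInverseˡ i)) (trans (to-cong
      (index′-injective (from i) (from j) (power-view (from i)) (power-view (from j)) same)) (strictlyInverseˡ j))

  -- Among 0 and the powers of γ with exponents 0 to N - 1, two coincide. As 0 is not a power of γ,
  -- the collision is between two powers, and their exponents differ by at most N - 1.
  period-≤ : ∃[ k ] (γ ^ suc k ≈ 1# × suc (suc k) ℕ.≤ N)
  period-≤ = let i , j , i<j , eq = Fin.pigeonhole (ℕ.n<1+n N) holes in cases i j i<j eq
    where
    holes : Fin (suc N) → Fin N
    holes zero    = to 0#
    holes (suc i) = to (γ ^ toℕ i)

    cases : ∀ i j → i Fin.< j → holes i ≡ holes j → ∃[ k ] (γ ^ suc k ≈ 1# × suc (suc k) ℕ.≤ N)
    cases zero    (suc j) _ eq = contradiction (≈-sym (to-injective eq)) (γ^≉0 (toℕ j))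
    cases (suc i) (suc j) (s≤s i<j) eq with k , j≡ ← ℕ.m≤n⇒∃[o]m+o≡n i<j =
      k , γ^-+-cancel (toℕ i) (suc k) (≈-trans (reflexive (cong (γ ^_) j≡′)) (≈-sym (to-injective eq))) ,
      ℕ.≤-<-trans (ℕ.≤-trans (ℕ.m≤n+m (suc k) (toℕ i)) (ℕ.≤-reflexive j≡′)) (Fin.toℕ<n j)
      where
      j≡′ : toℕ i ℕ.+ suc k ≡ toℕ j
      j≡′ = trans (ℕ.+-suc (toℕ i) k) j≡

  -- The order N - 1 of γ is written `suc N-2`, so that it is visibly nonzero when remainders are
  -- taken.
  N-2 : ℕ
  N-2 = proj₁ period-≤

  N≡2+ : N ≡ suc (suc N-2)
  N≡2+ = ℕ.≤-antisym (period-≥ N-2 (proj₁ (proj₂ period-≤))) (proj₂ (proj₂ period-≤))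

  γ^[N-1]≈1 : γ ^ suc N-2 ≈ 1#
  γ^[N-1]≈1 = proj₁ (proj₂ period-≤)

  order-∣ : ∀ {k} → γ ^ k ≈ 1# → suc N-2 ∣ k
  order-∣ {k} eq = ∣.m%n≡0⇒n∣m k (suc N-2) (zero-remainder (k % suc N-2) (m%n<n k (suc N-2))
      (≈-trans (≈-sym (^-% γ^[N-1]≈1 k)) eq))
    where
    zero-remainder : ∀ r → r ℕ.< suc N-2 → γ ^ r ≈ 1# → r ≡ 0
    zero-remainder zero    _   _  = refl
    zero-remainder (suc r) r<M eq = contradiction
      (ℕ.≤-trans (ℕ.≤-reflexive (sym N≡2+)) (period-≥ r eq)) (ℕ.<⇒≱ (s≤s r<M))

  -- Classes as residues of the logarithm modulo n

  module Class (n : ℕ) .{{_ : NonZero n}} (n∣N-1 : n ∣ suc N-2) where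
    open Cyclotomic n using (𝒜; 𝒜?; natural-exponent)

    -- Logarithms are determined only modulo the order of γ, but n divides that order. Hence `class`
    -- does not depend on the exponent that `power-view` happens to choose.
    γ^-%-injective : ∀ a b → γ ^ a ≈ γ ^ b → a % n ≡ b % n
    γ^-%-injective a b eq with ℕ.≤-total a b
    ... | inj₁ a≤b with c , refl ← ℕ.m≤n⇒∃[o]m+o≡n a≤b =
      sym (%-remove-+ʳ a (∣.∣-trans n∣N-1 (order-∣ (γ^-+-cancel a c (≈-sym eq)))))
    ... | inj₂ b≤a with c , refl ← ℕ.m≤n⇒∃[o]m+o≡n b≤a =
      %-remove-+ʳ b (∣.∣-trans n∣N-1 (order-∣ (γ^-+-cancel b c eq)))

    toℕ-mod : ∀ a → toℕ (a mod n) ≡ a % n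
    toℕ-mod a = Fin.toℕ-fromℕ< (m%n<n a n)

    mod-cong : ∀ {a b} → a % n ≡ b % n → a mod n ≡ b mod n
    mod-cong {a} {b} eq = Fin.toℕ-injective (trans (toℕ-mod a) (trans eq (sym (toℕ-mod b))))

    class′ : ∀ x → x ≈ 0# ⊎ (∃[ k ] x ≈ γ ^ k) → Fin (suc n)
    class′ x (inj₁ _)       = zero
    class′ x (inj₂ (k , _)) = suc (k mod n)

    -- 0 for the zero element, and k for the elements of 𝒜ₖ.
    class : Carrier → Fin (suc n)
    class x = class′ x (power-view x)

    class-zero : ∀ {x} → x ≈ 0# → class x ≡ zero
    class-zero {x} x≈0 with power-view x
    ... | inj₁ _        = refl
    ... | inj₂ (k , x≈) = contradiction (≈-trans (≈-sym x≈) x≈0) (γ^≉0 k)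

    class-power : ∀ {x} a → x ≈ γ ^ a → class x ≡ suc (a mod n)
    class-power {x} a x≈ with power-view x
    ... | inj₁ x≈0       = contradiction (≈-trans (≈-sym x≈) x≈0) (γ^≉0 a)
    ... | inj₂ (k , x≈′) = cong suc (mod-cong (γ^-%-injective k a (≈-trans (≈-sym x≈′) x≈)))

    class-zero⁻¹ : ∀ {x} → class x ≡ zero → x ≈ 0#
    class-zero⁻¹ {x} eq with power-view x
    ... | inj₁ x≈0 = x≈0

    class-suc⁻¹ : ∀ {x k} → class x ≡ suc k → ∃[ a ] (x ≈ γ ^ a × a % n ≡ toℕ k)
    class-suc⁻¹ {x} eq with power-view x
    ... | inj₂ (a , x≈) = a , x≈ , trans (sym (toℕ-mod a)) (cong toℕ (Fin.suc-injective eq))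

    class-cong : ∀ {x y} → x ≈ y → class x ≡ class y
    class-cong {x} {y} x≈y with power-view x
    ... | inj₁ x≈0      = sym (class-zero (≈-trans (≈-sym x≈y) x≈0))
    ... | inj₂ (a , x≈) = sym (class-power a (≈-trans (≈-sym x≈y) x≈))

    class-scale : ∀ {e} → n ∣ e → ∀ x → class (γ ^ e * x) ≡ class x
    class-scale {e} n∣e x with power-view x
    ... | inj₁ x≈0      = class-zero (≈-trans (F.*-congˡ x≈0) (F.zeroʳ _))
    ... | inj₂ (a , x≈) = trans (class-power (e ℕ.+ a) (≈-trans (F.*-congˡ x≈) (≈-sym (^-homo-* γ e a))))
                            (cong suc (mod-cong (%-remove-+ˡ a n∣e)))

    representative : Fin (suc n) → Carrier
    representative zero    = 0#
    representative (suc k) = γ ^ toℕ k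

    class-representative : ∀ k → class (representative k) ≡ k
    class-representative zero    = class-zero ≈-refl
    class-representative (suc k) = trans (class-power (toℕ k) ≈-refl)
      (cong suc (Fin.toℕ-injective (trans (toℕ-mod (toℕ k)) (m<n⇒m%n≡m (Fin.toℕ<n k)))))

    𝒜⇒class : ∀ {k x} → 𝒜 k x → class x ≡ suc k
    𝒜⇒class {k} {x} (α , (t , α≈) , x≈) with l , eq ← natural-exponent t =
      trans (class-cong (≈-trans x≈ (≈-trans (F.*-comm _ _) (F.*-congʳ (≈-trans α≈ eq)))))
        (trans (class-scale (∣.m∣m*n l) (γ ^ toℕ k)) (class-representative (suc k)))

    class⇒𝒜 : ∀ {k x} → class x ≡ suc k → 𝒜 k x
    class⇒𝒜 {k} {x} eq with a , x≈ , a%n≡k ← class-suc⁻¹ {x} eq =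
      _ , (+ (a ℕ./ n) , ≈-refl) , (S.begin
        x                                      S.≈⟨ x≈ ⟩
        γ ^ a                                  S.≡⟨ cong (γ ^_) (trans (m≡m%n+[m/n]*n a n)
                                                     (cong₂ ℕ._+_ a%n≡k (ℕ.*-comm (a ℕ./ n) n))) ⟩
        γ ^ (toℕ k ℕ.+ n ℕ.* (a ℕ./ n))        S.≈⟨ ^-homo-* γ (toℕ k) _ ⟩
        γ ^ toℕ k * γ ^ (n ℕ.* (a ℕ./ n))      S.≡⟨ cong (λ t → γ ^ toℕ k * powℤ γ γ≉0 t) (ℤ.pos-* n (a ℕ./ n)) ⟩
        γ ^ toℕ k * powℤ γ γ≉0 (+ n ℤ.* + (a ℕ./ n)) S.∎)

    does-𝒜? : ∀ k x → does (𝒜? k x) ≡ does (class x Fin.≟ suc k)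
    does-𝒜? k x = does-⇔ (mk⇔ 𝒜⇒class class⇒𝒜) (𝒜? k x) (class x Fin.≟ suc k)

    -- The ratio of z and w is computed without inverses: γᵇ = γ^(b + a(N - 2)) γᵃ.
    same-class-ratio : ∀ {z w} → class z ≡ class w → ∃[ e ] (n ∣ e × w ≈ γ ^ e * z)
    same-class-ratio {z} {w} eq with power-view z | power-view w
    ... | inj₁ z≈0 | inj₁ w≈0 = 0 , ∣._∣0 n , ≈-trans w≈0 (≈-sym (≈-trans (F.*-identityˡ z) z≈0))
    ... | inj₂ (a , z≈) | inj₂ (b , w≈) = b ℕ.+ a ℕ.* N-2 ,
      ∣.m%n≡0⇒n∣m _ n (begin
        (b ℕ.+ a ℕ.* N-2) % n             ≡⟨ %-distribˡ-+ b (a ℕ.* N-2) n ⟩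
        (b % n ℕ.+ a ℕ.* N-2 % n) % n     ≡⟨ cong (λ r → (r ℕ.+ a ℕ.* N-2 % n) % n) a%n≡b%n ⟨
        (a % n ℕ.+ a ℕ.* N-2 % n) % n     ≡⟨ %-distribˡ-+ a (a ℕ.* N-2) n ⟨
        (a ℕ.+ a ℕ.* N-2) % n             ≡⟨ cong (_% n) (ℕ.*-suc a N-2) ⟨
        (a ℕ.* suc N-2) % n               ≡⟨ ∣.n∣m⇒m%n≡0 _ n (∣.∣n⇒∣m*n a n∣N-1) ⟩
        0                                 ∎) ,
      (S.begin
        w                                 S.≈⟨ w≈ ⟩
        γ ^ b                             S.≈⟨ F.*-identityʳ _ ⟨
        γ ^ b * 1#                        S.≈⟨ F.*-congˡ (^-multiple γ^[N-1]≈1 a) ⟨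
        γ ^ b * γ ^ (a ℕ.* suc N-2)       S.≈⟨ ^-homo-* γ b _ ⟨
        γ ^ (b ℕ.+ a ℕ.* suc N-2)         S.≡⟨ cong (γ ^_) exponent ⟩
        γ ^ (b ℕ.+ a ℕ.* N-2 ℕ.+ a)       S.≈⟨ ^-homo-* γ (b ℕ.+ a ℕ.* N-2) a ⟩
        γ ^ (b ℕ.+ a ℕ.* N-2) * γ ^ a     S.≈⟨ F.*-congˡ z≈ ⟨
        γ ^ (b ℕ.+ a ℕ.* N-2) * z         S.∎)
      where
      a%n≡b%n : a % n ≡ b % n
      a%n≡b%n = trans (sym (toℕ-mod a)) (trans (cong toℕ (Fin.suc-injective eq)) (toℕ-mod b))
      exponent : b ℕ.+ a ℕ.* suc N-2 ≡ b ℕ.+ a ℕ.* N-2 ℕ.+ a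
      exponent = trans (cong (b ℕ.+_) (trans (ℕ.*-suc a N-2) (ℕ.+-comm a _))) (sym (ℕ.+-assoc b _ a))

-- The classes span a Schur ring

module SchurRing {a ℓ} {F : CommutativeRing a ℓ} {p m : ℕ} (pr : Prime p)
  (isFF : IsFiniteField F (p ℕ.^ m)) {γ : CommutativeRing.Carrier F} (prim : IsPrimitive isFF γ)
  (n : ℕ) .{{_ : NonZero n}} (n∣N-1 : n ∣ suc (DiscreteLogarithm.N-2 {m = m} pr isFF prim)) where

  open CommutativeRing F
    using (Carrier; _≈_; _+_; _*_; _-_; -_; 0#; 1#; setoid; semiring; reflexive)
    renaming (refl to ≈-refl; sym to ≈-sym; trans to ≈-trans)
  private module F = CommutativeRing F
  open IsFiniteField isFF
  open Inverse enumeration using (to; from; to-cong; strictlyInverseˡ; strictlyInverseʳ)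
  open Exponentiation semiring
  open Multiplication semiring using (×-assocˡ; ×-congʳ) renaming (_×_ to _×ₙ_)
  open PrimitiveElement {m = m} pr isFF prim
  open Cyclotomic n using (𝒜; 𝒜?; q)
  open GroupAlgebra {m = m} pr isFF prim
  open DiscreteLogarithm {m = m} pr isFF prim
  open Class n n∣N-1
  open AbelianGroupProperties F.+-abelianGroup using (//-rightDividesˡ; //-rightDividesʳ; ⁻¹-involutive; inverseˡ-unique)
  open RingProperties F.ring using (-1*x≈-x; x[y-z]≈xy-xz)
  private module S = SetoidReasoning setoid

  χ : Fin (suc n) → Carrier → ℕ
  χ k x = ind (does (class x Fin.≟ k))

  χ-cong : ∀ k {x y} → x ≈ y → χ k x ≡ χ k y
  χ-cong k x≈y = cong (λ c → ind (does (c Fin.≟ k))) (class-cong x≈y)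

  does-class-zero : ∀ i → does (class (from i) Fin.≟ zero) ≡ does (to 0# Fin.≟ i)
  does-class-zero i = does-⇔ (mk⇔
    (λ eq → trans (to-cong (≈-sym (class-zero⁻¹ {from i} eq))) (strictlyInverseˡ i))
    (λ eq → class-zero (≈-trans (reflexive (cong from (sym eq))) (strictlyInverseʳ 0#))))
    (class (from i) Fin.≟ zero) (to 0# Fin.≟ i)

  -- With q₀ read as the indicator of the class {0}, all n + 1 generators get one uniform formula,
  -- and products need no case distinction.
  E-q : ∀ k Φ → Congruent Φ → E (q k) Φ ≡ Σℚ.sum (λ i → ι (χ k (from i)) ℚ.* Φ (from i))
  E-q zero Φ Φ-cong = begin
    E (q zero) Φ                    ≡⟨ ⟪⟫-monomial (Vec.replicate m 0) (Φ ∘ ψ) ⟩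
    Φ (ψ (Vec.replicate m 0))       ≡⟨ Φ-cong (≈-trans ψ-0 (≈-sym (strictlyInverseʳ 0#))) ⟩
    Φ (from (to 0#))                ≡⟨ sum-indicator ℚ.+-0-commutativeMonoid (to 0#) (Φ ∘ from) ⟨
    Σℚ.sum (λ i → if does (to 0# Fin.≟ i) then Φ (from i) else 0ℚ)
      ≡⟨ Σℚ.sum-cong-≗ (λ i → trans (ind-if (does (to 0# Fin.≟ i)) (Φ (from i)))
           (cong (λ b → ι (ind b) ℚ.* Φ (from i)) (sym (does-class-zero i)))) ⟩
    Σℚ.sum (λ i → ι (χ zero (from i)) ℚ.* Φ (from i)) ∎
  E-q (suc k) Φ Φ-cong = trans (E-charPoly (𝒜? k) Φ Φ-cong) (Σℚ.sum-cong-≗ (λ i →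
    trans (ind-if (does (𝒜? k (from i))) (Φ (from i)))
      (cong (λ b → ι (ind b) ℚ.* Φ (from i)) (does-𝒜? k (from i)))))

  -- The number of (x , y) in the classes i and j with x + y = z.
  ν : Fin (suc n) → Fin (suc n) → Carrier → ℕ
  ν i j z = Σℕ.sum (λ x → χ i (from x) ℕ.* χ j (z - from x))

  ν-cong : ∀ i j {z w} → z ≈ w → ν i j z ≡ ν i j w
  ν-cong i j z≈w = Σℕ.sum-cong-≗ (λ x → cong (χ i (from x) ℕ.*_) (χ-cong j (F.+-congʳ z≈w)))

  sum-scale : ∀ e (f : Carrier → ℕ) → (∀ {x y} → x ≈ y → f x ≡ f y) →
              Σℕ.sum (f ∘ from) ≡ Σℕ.sum (λ x → f (γ ^ e * from x))
  sum-scale e = sum-substitute (γ ^ e *_) (δ ^ e *_) F.*-congˡ F.*-congˡ (^-inv γδ≈1 e) (^-inv δγ≈1 e) ℕ.+-0-commutativeMonoid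

  -- Substitute γᵉx for x in the sum: γᵉz - γᵉx = γᵉ(z - x), and neither class test notices the
  -- factor γᵉ.
  ν-scale : ∀ i j {e} → n ∣ e → ∀ z → ν i j (γ ^ e * z) ≡ ν i j z
  ν-scale i j {e} n∣e z = begin
    Σℕ.sum (λ x → χ i (from x) ℕ.* χ j (γ ^ e * z - from x))
      ≡⟨ sum-scale e (λ x → χ i x ℕ.* χ j (γ ^ e * z - x))
           (λ x≈y → cong₂ ℕ._*_ (χ-cong i x≈y) (χ-cong j (F.+-congˡ (F.-‿cong x≈y)))) ⟩
    Σℕ.sum (λ x → χ i (γ ^ e * from x) ℕ.* χ j (γ ^ e * z - γ ^ e * from x))
      ≡⟨ Σℕ.sum-cong-≗ (λ x → cong₂ (λ c d → ind (does (c Fin.≟ i)) ℕ.* ind (does (d Fin.≟ j)))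
           (class-scale n∣e (from x))
           (trans (class-cong (≈-sym (x[y-z]≈xy-xz (γ ^ e) z (from x)))) (class-scale n∣e (z - from x)))) ⟩
    Σℕ.sum (λ x → χ i (from x) ℕ.* χ j (z - from x)) ∎

  ν-class : ∀ i j {z w} → class z ≡ class w → ν i j w ≡ ν i j z
  ν-class i j {z} {w} eq with e , n∣e , w≈ ← same-class-ratio {z} {w} eq =
    trans (ν-cong i j w≈) (ν-scale i j n∣e z)

  structure : Fin (suc n) → Fin (suc n) → Fin (suc n) → ℕ
  structure i j k = ν i j (representative k)

  -- Setting z = x + y in the double sum and exchanging the sums gives Φ z the coefficient
  -- `ν i j z`. This is replaced by its value at the representative of the class of z, and the terms
  -- are regrouped by class.
  E-q*q : ∀ i j Φ → Congruent Φ →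
          E (q i *ₚ q j) Φ ≡ Σℚ.sum (λ k → ι (structure i j k) ℚ.* E (q k) Φ)
  E-q*q i j Φ Φ-cong = begin
    E (q i *ₚ q j) Φ
      ≡⟨ E-* (q i) (q j) Φ Φ-cong ⟩
    E (q i) (λ x → E (q j) (λ y → Φ (x + y)))
      ≡⟨ E-q i _ (translate-congruent (q j) Φ-cong) ⟩
    Σℚ.sum (λ x → ι (χ i (from x)) ℚ.* E (q j) (λ y → Φ (from x + y)))
      ≡⟨ Σℚ.sum-cong-≗ (λ x → trans (cong (ι (χ i (from x)) ℚ.*_) (inner (from x)))
           (trans (Σℚ.*-distribˡ-sum (ι (χ i (from x))) (λ z → ι (χ j (from z - from x)) ℚ.* Φ (from z)))
             (Σℚ.sum-cong-≗ (λ z → trans (sym (ℚ.*-assoc (ι (χ i (from x))) _ (Φ (from z))))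
               (cong (ℚ._* Φ (from z)) (sym (ι-ind-* (does (class (from x) Fin.≟ i)) (χ j (from z - from x))))))))) ⟩
    Σℚ.sum (λ x → Σℚ.sum (λ z → ι (χ i (from x) ℕ.* χ j (from z - from x)) ℚ.* Φ (from z)))
      ≡⟨ Σℚ.∑-comm (λ x z → ι (χ i (from x) ℕ.* χ j (from z - from x)) ℚ.* Φ (from z)) ⟩
    Σℚ.sum (λ z → Σℚ.sum (λ x → ι (χ i (from x) ℕ.* χ j (from z - from x)) ℚ.* Φ (from z)))
      ≡⟨ Σℚ.sum-cong-≗ (λ z → trans
           (sym (Σℚ.*-distribʳ-sum (Φ (from z)) (λ x → ι (χ i (from x) ℕ.* χ j (from z - from x)))))
           (trans (cong (ℚ._* Φ (from z)) (sym (ι-sum (λ x → χ i (from x) ℕ.* χ j (from z - from x)))))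
             (by-class (from z)))) ⟩
    Σℚ.sum (λ z → Σℚ.sum (λ k → ι (structure i j k) ℚ.* (ι (χ k (from z)) ℚ.* Φ (from z))))
      ≡⟨ Σℚ.∑-comm (λ z k → ι (structure i j k) ℚ.* (ι (χ k (from z)) ℚ.* Φ (from z))) ⟩
    Σℚ.sum (λ k → Σℚ.sum (λ z → ι (structure i j k) ℚ.* (ι (χ k (from z)) ℚ.* Φ (from z))))
      ≡⟨ Σℚ.sum-cong-≗ (λ k → trans
           (sym (Σℚ.*-distribˡ-sum (ι (structure i j k)) (λ z → ι (χ k (from z)) ℚ.* Φ (from z))))
           (cong (ι (structure i j k) ℚ.*_) (sym (E-q k Φ Φ-cong)))) ⟩
    Σℚ.sum (λ k → ι (structure i j k) ℚ.* E (q k) Φ) ∎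
    where
    inner : ∀ x → E (q j) (λ y → Φ (x + y)) ≡ Σℚ.sum (λ z → ι (χ j (from z - x)) ℚ.* Φ (from z))
    inner x = begin
      E (q j) (λ y → Φ (x + y))
        ≡⟨ E-q j _ (λ y≈z → Φ-cong (F.+-congˡ y≈z)) ⟩
      Σℚ.sum (λ y → ι (χ j (from y)) ℚ.* Φ (x + from y))
        ≡⟨ sum-substitute (_- x) (_+ x) F.+-congʳ F.+-congʳ (//-rightDividesʳ x) (//-rightDividesˡ x)
             ℚ.+-0-commutativeMonoid (λ y → ι (χ j y) ℚ.* Φ (x + y))
             (λ y≈z → cong₂ (λ c v → ι c ℚ.* v) (χ-cong j y≈z) (Φ-cong (F.+-congˡ y≈z))) ⟩
      Σℚ.sum (λ z → ι (χ j (from z - x)) ℚ.* Φ (x + (from z - x)))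
        ≡⟨ Σℚ.sum-cong-≗ (λ z → cong (ι (χ j (from z - x)) ℚ.*_)
             (Φ-cong (≈-trans (F.+-comm x _) (//-rightDividesˡ x (from z))))) ⟩
      Σℚ.sum (λ z → ι (χ j (from z - x)) ℚ.* Φ (from z)) ∎

    by-class : ∀ z → ι (ν i j z) ℚ.* Φ z ≡ Σℚ.sum (λ k → ι (structure i j k) ℚ.* (ι (χ k z) ℚ.* Φ z))
    by-class z = begin
      ι (ν i j z) ℚ.* Φ z
        ≡⟨ cong (λ c → ι c ℚ.* Φ z) (ν-class i j {z} {representative (class z)} (sym (class-representative (class z)))) ⟨
      ι (structure i j (class z)) ℚ.* Φ z
        ≡⟨ sum-indicator ℚ.+-0-commutativeMonoid (class z) (λ k → ι (structure i j k) ℚ.* Φ z) ⟨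
      Σℚ.sum (λ k → if does (class z Fin.≟ k) then ι (structure i j k) ℚ.* Φ z else 0ℚ)
        ≡⟨ Σℚ.sum-cong-≗ (λ k → trans (ind-if (does (class z Fin.≟ k)) _)
             (solve 3 (λ b c x → b :* (c :* x) := c :* (b :* x)) refl (ι (χ k z)) (ι (structure i j k)) (Φ z))) ⟩
      Σℚ.sum (λ k → ι (structure i j k) ℚ.* (ι (χ k z) ℚ.* Φ z)) ∎

  -- Closure of the span under the algebra operations

  Spanned : ((Carrier → ℚ) → ℚ) → Set _
  Spanned Λ = Σ[ b ∈ (Fin (suc n) → ℚ) ] (∀ Φ → Congruent Φ → Λ Φ ≡ Σℚ.sum (λ k → b k ℚ.* E (q k) Φ))

  E-∑• : ∀ (b : Fin (suc n) → ℚ) Φ → E (∑ₚ (λ k → b k •ₚ q k)) Φ ≡ Σℚ.sum (λ k → b k ℚ.* E (q k) Φ)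
  E-∑• b Φ = trans (⟪⟫-∑ (λ k → b k •ₚ q k) (Φ ∘ ψ)) (Σℚ.sum-cong-≗ (λ k → ⟪⟫-• (b k) (q k) (Φ ∘ ψ)))

  Span⇒Spanned : ∀ f → Span p q f → Spanned (E f)
  Span⇒Spanned f (b , eq) = b , λ Φ Φ-cong →
    trans (mod⇒≋ f (∑ₚ (λ k → b k •ₚ q k)) eq Φ Φ-cong) (E-∑• b Φ)

  Spanned⇒Span : ∀ f → Spanned (E f) → Span p q f
  Spanned⇒Span f (b , eq) = b , ≋⇒mod f (∑ₚ (λ k → b k •ₚ q k))
    (λ Φ Φ-cong → trans (eq Φ Φ-cong) (sym (E-∑• b Φ)))

  -- Stated for functionals rather than polynomials, so that it can be nested: the double
  -- combination of the qᵢqⱼ arising from a product is never written out as a polynomial.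
  Spanned-combination : ∀ {r} (c : Fin r → ℚ) (Λ : Fin r → (Carrier → ℚ) → ℚ) →
    (∀ i → Spanned (Λ i)) → Spanned (λ Φ → Σℚ.sum (λ i → c i ℚ.* Λ i Φ))
  Spanned-combination c Λ spanned = (λ k → Σℚ.sum (λ i → c i ℚ.* b i k)) , λ Φ Φ-cong → begin
    Σℚ.sum (λ i → c i ℚ.* Λ i Φ)
      ≡⟨ Σℚ.sum-cong-≗ (λ i → trans (cong (c i ℚ.*_) (proj₂ (spanned i) Φ Φ-cong))
           (trans (Σℚ.*-distribˡ-sum (c i) (λ k → b i k ℚ.* E (q k) Φ))
             (Σℚ.sum-cong-≗ (λ k → sym (ℚ.*-assoc (c i) (b i k) (E (q k) Φ)))))) ⟩
    Σℚ.sum (λ i → Σℚ.sum (λ k → c i ℚ.* b i k ℚ.* E (q k) Φ))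
      ≡⟨ Σℚ.∑-comm (λ i k → c i ℚ.* b i k ℚ.* E (q k) Φ) ⟩
    Σℚ.sum (λ k → Σℚ.sum (λ i → c i ℚ.* b i k ℚ.* E (q k) Φ))
      ≡⟨ Σℚ.sum-cong-≗ (λ k → sym (Σℚ.*-distribʳ-sum (E (q k) Φ) (λ i → c i ℚ.* b i k))) ⟩
    Σℚ.sum (λ k → Σℚ.sum (λ i → c i ℚ.* b i k) ℚ.* E (q k) Φ) ∎
    where
    b : _ → Fin (suc n) → ℚ
    b i = proj₁ (spanned i)

  Spanned-resp : ∀ {Λ Λ′} → (∀ Φ → Congruent Φ → Λ′ Φ ≡ Λ Φ) → Spanned Λ → Spanned Λ′
  Spanned-resp eq (b , spanned) = b , λ Φ Φ-cong → trans (eq Φ Φ-cong) (spanned Φ Φ-cong)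

  -- The expansion of f is applied to the function that integrates the translates of Φ against g;
  -- inside it, the expansion of g is applied to each translate. Only the products qᵢqⱼ are left.
  Spanned-* : ∀ f g → Spanned (E f) → Spanned (E g) → Spanned (E (f *ₚ g))
  Spanned-* f g (b , f≋) (c , g≋) = Spanned-resp expand
    (Spanned-combination b (λ i Φ → Σℚ.sum (λ j → c j ℚ.* E (q i *ₚ q j) Φ)) (λ i →
      Spanned-combination c (λ j → E (q i *ₚ q j)) (λ j → (λ k → ι (structure i j k)) , E-q*q i j)))
    where
    expand : ∀ Φ → Congruent Φ → E (f *ₚ g) Φ ≡ Σℚ.sum (λ i → b i ℚ.* Σℚ.sum (λ j → c j ℚ.* E (q i *ₚ q j) Φ))
    expand Φ Φ-cong = begin
      E (f *ₚ g) Φ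
        ≡⟨ E-* f g Φ Φ-cong ⟩
      E f (λ x → E g (λ y → Φ (x + y)))
        ≡⟨ f≋ _ (translate-congruent g Φ-cong) ⟩
      Σℚ.sum (λ i → b i ℚ.* E (q i) (λ x → E g (λ y → Φ (x + y))))
        ≡⟨ Σℚ.sum-cong-≗ (λ i → cong (b i ℚ.*_) (begin
             E (q i) (λ x → E g (λ y → Φ (x + y)))
               ≡⟨ E-cong (q i) (λ x → g≋ (λ y → Φ (x + y)) (λ y≈z → Φ-cong (F.+-congˡ y≈z))) ⟩
             E (q i) (λ x → Σℚ.sum (λ j → c j ℚ.* E (q j) (λ y → Φ (x + y))))
               ≡⟨ ⟪⟫-linear (q i) c (λ j d → E (q j) (λ y → Φ (ψ d + y))) ⟩
             Σℚ.sum (λ j → c j ℚ.* E (q i) (λ x → E (q j) (λ y → Φ (x + y))))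
               ≡⟨ Σℚ.sum-cong-≗ (λ j → cong (c j ℚ.*_) (sym (E-* (q i) (q j) Φ Φ-cong))) ⟩
             Σℚ.sum (λ j → c j ℚ.* E (q i *ₚ q j) Φ) ∎)) ⟩
      Σℚ.sum (λ i → b i ℚ.* Σℚ.sum (λ j → c j ℚ.* E (q i *ₚ q j) Φ)) ∎

  Spanned-1 : Spanned (E 1ₚ)
  Spanned-1 = b , λ Φ _ → sym (trans (cong₂ ℚ._+_ (ℚ.*-identityˡ (E (q zero) Φ))
      (trans (Σℚ.sum-cong-≗ (λ k → ℚ.*-zeroˡ (E (q (suc k)) Φ))) (Σℚ.sum-replicate-zero n))) (ℚ.+-identityʳ (E (q zero) Φ)))
    where
    b : Fin (suc n) → ℚ
    b zero    = 1ℚ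
    b (suc _) = 0ℚ

  Spanned-+ : ∀ f g → Spanned (E f) → Spanned (E g) → Spanned (E (f +ₚ g))
  Spanned-+ f g (b , f≋) (c , g≋) = (λ k → b k ℚ.+ c k) , λ Φ Φ-cong → begin
    E (f +ₚ g) Φ                                            ≡⟨ ⟪⟫-+ f g (Φ ∘ ψ) ⟩
    E f Φ ℚ.+ E g Φ                                         ≡⟨ cong₂ ℚ._+_ (f≋ Φ Φ-cong) (g≋ Φ Φ-cong) ⟩
    Σℚ.sum (λ k → b k ℚ.* E (q k) Φ) ℚ.+ Σℚ.sum (λ k → c k ℚ.* E (q k) Φ)
      ≡⟨ Σℚ.∑-distrib-+ (λ k → b k ℚ.* E (q k) Φ) (λ k → c k ℚ.* E (q k) Φ) ⟨
    Σℚ.sum (λ k → b k ℚ.* E (q k) Φ ℚ.+ c k ℚ.* E (q k) Φ)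
      ≡⟨ Σℚ.sum-cong-≗ (λ k → sym (ℚ.*-distribʳ-+ (E (q k) Φ) (b k) (c k))) ⟩
    Σℚ.sum (λ k → (b k ℚ.+ c k) ℚ.* E (q k) Φ)              ∎

  Spanned-• : ∀ c f → Spanned (E f) → Spanned (E (c •ₚ f))
  Spanned-• c f (b , f≋) = (λ k → c ℚ.* b k) , λ Φ Φ-cong → begin
    E (c •ₚ f) Φ                                  ≡⟨ ⟪⟫-• c f (Φ ∘ ψ) ⟩
    c ℚ.* E f Φ                                   ≡⟨ cong (c ℚ.*_) (f≋ Φ Φ-cong) ⟩
    c ℚ.* Σℚ.sum (λ k → b k ℚ.* E (q k) Φ)        ≡⟨ Σℚ.*-distribˡ-sum c (λ k → b k ℚ.* E (q k) Φ) ⟩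
    Σℚ.sum (λ k → c ℚ.* (b k ℚ.* E (q k) Φ))      ≡⟨ Σℚ.sum-cong-≗ (λ k → sym (ℚ.*-assoc c (b k) (E (q k) Φ))) ⟩
    Σℚ.sum (λ k → c ℚ.* b k ℚ.* E (q k) Φ)        ∎

  isSubalgebra : IsSubalgebra p m (Span p q)
  isSubalgebra = record
    { resp     = λ {f} {g} f≡g Vf → Spanned⇒Span g (Spanned-resp {E f}
                   (λ Φ Φ-cong → sym (mod⇒≋ f g f≡g Φ Φ-cong)) (Span⇒Spanned f Vf))
    ; 0-closed = Spanned⇒Span 0ₚ ((λ _ → 0ℚ) , λ Φ _ → sym (trans
                   (Σℚ.sum-cong-≗ (λ k → ℚ.*-zeroˡ (E (q k) Φ))) (Σℚ.sum-replicate-zero (suc n))))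
    ; 1-closed = Spanned⇒Span 1ₚ Spanned-1
    ; +-closed = λ {f} {g} Vf Vg → Spanned⇒Span (f +ₚ g) (Spanned-+ f g (Span⇒Spanned f Vf) (Span⇒Spanned g Vg))
    ; •-closed = λ c {f} Vf → Spanned⇒Span (c •ₚ f) (Spanned-• c f (Span⇒Spanned f Vf))
    ; *-closed = λ {f} {g} Vf Vg → Spanned⇒Span (f *ₚ g) (Spanned-* f g (Span⇒Spanned f Vf) (Span⇒Spanned g Vg))
    }

  product-expansion : ∀ i j → q i *ₚ q j
    ≡ const (ι (structure i j zero)) +ₚ ∑ₚ (λ k → ι (structure i j (suc k)) •ₚ q (suc k)) mod[x^ p -1]
  product-expansion i j = ≋⇒mod (q i *ₚ q j)
    (const (ι (structure i j zero)) +ₚ ∑ₚ (λ k → ι (structure i j (suc k)) •ₚ q (suc k))) λ Φ Φ-cong → begin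
    E (q i *ₚ q j) Φ
      ≡⟨ E-q*q i j Φ Φ-cong ⟩
    ι (c zero) ℚ.* E (q zero) Φ ℚ.+ Σℚ.sum (λ k → ι (c (suc k)) ℚ.* E (q (suc k)) Φ)
      ≡⟨ cong₂ ℚ._+_ (trans (cong (ι (c zero) ℚ.*_) (⟪⟫-monomial (Vec.replicate m 0) (Φ ∘ ψ)))
                       (sym (⟪⟫-const (ι (c zero)) (Φ ∘ ψ))))
                     (trans (Σℚ.sum-cong-≗ (λ k → sym (⟪⟫-• (ι (c (suc k))) (q (suc k)) (Φ ∘ ψ))))
                       (sym (⟪⟫-∑ (λ k → ι (c (suc k)) •ₚ q (suc k)) (Φ ∘ ψ)))) ⟩
    E (const (ι (c zero))) Φ ℚ.+ E (∑ₚ (λ k → ι (c (suc k)) •ₚ q (suc k))) Φ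
      ≡⟨ ⟪⟫-+ (const (ι (c zero))) (∑ₚ (λ k → ι (c (suc k)) •ₚ q (suc k))) (Φ ∘ ψ) ⟨
    E (const (ι (c zero)) +ₚ ∑ₚ (λ k → ι (c (suc k)) •ₚ q (suc k))) Φ ∎
    where
    c : Fin (suc n) → ℕ
    c = structure i j

  -- Sizes of the classes and the constant terms

  card : Fin (suc n) → ℕ
  card k = Σℕ.sum (λ x → χ k (from x))

  card-zero : card zero ≡ 1
  card-zero = trans (Σℕ.sum-cong-≗ (λ i → cong ind (does-class-zero i)))
    (sum-indicator ℕ.+-0-commutativeMonoid (to 0#) (λ _ → 1))

  -- Rescaled by γᵏ and γˡ respectively, both counts run over the same set 𝒜₁; the element α
  -- witnessing one membership also witnesses the other.
  card-suc : ∀ k l → card (suc k) ≡ card (suc l)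
  card-suc k l = trans (rescale k) (trans (Σℕ.sum-cong-≗ (λ x → cong ind (trans (sym (does-𝒜? k _))
      (trans (does-⇔ (mk⇔ (shift k l) (shift l k)) (𝒜? k (γ ^ toℕ k * from x)) (𝒜? l (γ ^ toℕ l * from x)))
        (does-𝒜? l _))))) (sym (rescale l)))
    where
    shift : ∀ k l {x} → 𝒜 k (γ ^ toℕ k * x) → 𝒜 l (γ ^ toℕ l * x)
    shift k l (α , α∈𝒜₁ , eq) = α , α∈𝒜₁ , F.*-congˡ (γ^-cancel (toℕ k) eq)

    rescale : ∀ k → card (suc k) ≡ Σℕ.sum (λ x → χ (suc k) (γ ^ toℕ k * from x))
    rescale k = sum-scale (toℕ k) (χ (suc k)) (χ-cong (suc k))

  sum-card : Σℕ.sum card ≡ N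
  sum-card = begin
    Σℕ.sum (λ k → Σℕ.sum (λ x → χ k (from x))) ≡⟨ Σℕ.∑-comm (λ k x → χ k (from x)) ⟩
    Σℕ.sum (λ x → Σℕ.sum (λ k → χ k (from x))) ≡⟨ Σℕ.sum-cong-≗ (λ x → sum-indicator ℕ.+-0-commutativeMonoid (class (from x)) (λ _ → 1)) ⟩
    Σℕ.sum {N} (λ _ → 1)                       ≡⟨ trans (sum-const N 1) (ℕ.*-identityʳ N) ⟩
    N                                          ∎

  s : ℕ
  s = ∣.quotient n∣N-1

  N-1≡s*n : suc N-2 ≡ s ℕ.* n
  N-1≡s*n = _∣_.equality n∣N-1

  -- The n nonzero classes have equal size and together with 0 fill the field, so 1 + n ·
  -- `card (suc k)` = N = 1 + n · s.
  card≡s : ∀ k → card (suc k) ≡ s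
  card≡s k = ℕ.*-cancelˡ-≡ (card (suc k)) s n (ℕ.suc-injective (begin
    suc (n ℕ.* card (suc k))                        ≡⟨ cong suc (sum-const n (card (suc k))) ⟨
    suc (Σℕ.sum {n} (λ _ → card (suc k)))           ≡⟨ cong₂ ℕ._+_ card-zero (Σℕ.sum-cong-≗ (λ l → card-suc l k)) ⟨
    Σℕ.sum card                                     ≡⟨ sum-card ⟩
    N                                               ≡⟨ N≡2+ ⟩
    suc (suc N-2)                                   ≡⟨ cong suc (trans N-1≡s*n (ℕ.*-comm s n)) ⟩
    suc (n ℕ.* s)                                   ∎))

  χ-*-implied : ∀ i j x y → (class x ≡ i → class y ≡ j) → χ i x ℕ.* χ j y ≡ χ i x
  χ-*-implied i j x y implied with class x Fin.≟ i
  ... | yes eq = trans (ℕ.+-identityʳ _) (cong ind (dec-true (class y Fin.≟ j) (implied eq)))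
  ... | no  _  = refl

  χ-*-excluded : ∀ i j x y → (class x ≡ i → class y ≢ j) → χ i x ℕ.* χ j y ≡ 0
  χ-*-excluded i j x y excluded with class x Fin.≟ i
  ... | yes eq = trans (ℕ.+-identityʳ _) (cong ind (dec-false (class y Fin.≟ j) (excluded eq)))
  ... | no  _  = refl

  ν₀-implied : ∀ k j → (∀ x → class x ≡ suc k → class (0# - x) ≡ j) → ν (suc k) j 0# ≡ s
  ν₀-implied k j implied = trans
    (Σℕ.sum-cong-≗ (λ x → χ-*-implied (suc k) j (from x) (0# - from x) (implied (from x)))) (card≡s k)

  ν₀-excluded : ∀ i j → (∀ x → class x ≡ i → class (0# - x) ≢ j) → ν i j 0# ≡ 0
  ν₀-excluded i j excluded = trans
    (Σℕ.sum-cong-≗ (λ x → χ-*-excluded i j (from x) (0# - from x) (excluded (from x)))) (Σℕ.sum-replicate-zero N)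

  -- Negation of classes and the parity of s

  module Negation (e : ℕ) (-1≈γᵉ : - 1# ≈ γ ^ e) where

    negate≈ : ∀ x → 0# - x ≈ γ ^ e * x
    negate≈ x = ≈-trans (F.+-identityˡ (- x)) (≈-trans (≈-sym (-1*x≈-x x)) (F.*-congʳ -1≈γᵉ))

    module _ (n∣e : n ∣ e) where

      class-negate : ∀ x → class (0# - x) ≡ class x
      class-negate x = trans (class-cong (negate≈ x)) (class-scale n∣e x)

      diagonal : ∀ k → ν (suc k) (suc k) 0# ≡ s
      diagonal k = ν₀-implied k (suc k) (λ x → trans (class-negate x))

      off-diagonal : ∀ k l → l ≢ k → ν (suc k) (suc l) 0# ≡ 0
      off-diagonal k l l≢k = ν₀-excluded (suc k) (suc l) (λ x x∈k -x∈l →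
        l≢k (Fin.suc-injective (trans (sym -x∈l) (trans (class-negate x) x∈k))))

    module _ (n∤e : ¬ n ∣ e) where

      opposite : Fin n → Fin n
      opposite k = (e ℕ.+ toℕ k) mod n

      class-negate-suc : ∀ k x → class x ≡ suc k → class (0# - x) ≡ suc (opposite k)
      class-negate-suc k x x∈k with a , x≈ , a%n≡k ← class-suc⁻¹ {x} x∈k =
        trans (class-power (e ℕ.+ a) (≈-trans (negate≈ x) (≈-trans (F.*-congˡ x≈) (≈-sym (^-homo-* γ e a)))))
          (cong suc (mod-cong (begin
            (e ℕ.+ a) % n               ≡⟨ cong (λ z → (e ℕ.+ z) % n) (m≡m%n+[m/n]*n a n) ⟩
            (e ℕ.+ (a % n ℕ.+ a ℕ./ n ℕ.* n)) % n ≡⟨ cong (_% n) (ℕ.+-assoc e (a % n) _) ⟨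
            (e ℕ.+ a % n ℕ.+ a ℕ./ n ℕ.* n) % n ≡⟨ %-remove-+ʳ (e ℕ.+ a % n) (∣.n∣m*n (a ℕ./ n)) ⟩
            (e ℕ.+ a % n) % n           ≡⟨ cong (λ z → (e ℕ.+ z) % n) a%n≡k ⟩
            (e ℕ.+ toℕ k) % n           ∎)))

      opposite≢ : ∀ k → opposite k ≢ k
      opposite≢ k eq = n∤e (%-cancel n e (toℕ k) (begin
        (e ℕ.+ toℕ k) % n     ≡⟨ toℕ-mod (e ℕ.+ toℕ k) ⟨
        toℕ (opposite k)      ≡⟨ cong toℕ eq ⟩
        toℕ k                 ≡⟨ m<n⇒m%n≡m (Fin.toℕ<n k) ⟨
        toℕ k % n             ∎))

      diagonal-0 : ∀ k → ν (suc k) (suc k) 0# ≡ 0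
      diagonal-0 k = ν₀-excluded (suc k) (suc k) (λ x x∈k -x∈k →
        opposite≢ k (Fin.suc-injective (trans (sym (class-negate-suc k x x∈k)) -x∈k)))

      opposite-s : ∀ k → ν (suc k) (suc (opposite k)) 0# ≡ s
      opposite-s k = ν₀-implied k (suc (opposite k)) (class-negate-suc k)

    N-1∣e+e : suc N-2 ∣ e ℕ.+ e
    N-1∣e+e = order-∣ (S.begin
      γ ^ (e ℕ.+ e)     S.≈⟨ ^-homo-* γ e e ⟩
      γ ^ e * γ ^ e     S.≈⟨ F.*-congˡ -1≈γᵉ ⟨
      γ ^ e * - 1#      S.≈⟨ F.*-congʳ -1≈γᵉ ⟨
      - 1# * - 1#       S.≈⟨ -1*x≈-x (- 1#) ⟩
      - (- 1#)          S.≈⟨ ⁻¹-involutive 1# ⟩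
      1#                S.∎)

    s*n∣e*2 : s ℕ.* n ∣ e ℕ.* 2
    s*n∣e*2 = ≡.subst₂ _∣_ N-1≡s*n (trans (cong (e ℕ.+_) (sym (ℕ.+-identityʳ e))) (ℕ.*-comm 2 e)) N-1∣e+e

    -- For s = 2t, the divisibility of 2e by sn cancels to tn dividing e.
    even⇒n∣e : 2 ∣ s → n ∣ e
    even⇒n∣e (divides t s≡t*2) = ∣.m*n∣⇒n∣ t n (∣.*-cancelʳ-∣ 2
      (≡.subst (_∣ e ℕ.* 2) (begin
        s ℕ.* n             ≡⟨ cong (ℕ._* n) s≡t*2 ⟩
        t ℕ.* 2 ℕ.* n       ≡⟨ ℕ.*-assoc t 2 n ⟩
        t ℕ.* (2 ℕ.* n)     ≡⟨ cong (t ℕ.*_) (ℕ.*-comm 2 n) ⟩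
        t ℕ.* (n ℕ.* 2)     ≡⟨ ℕ.*-assoc t n 2 ⟨
        t ℕ.* n ℕ.* 2       ∎) s*n∣e*2))

    -- For e = un, cancelling n from sn dividing 2un gives 2u = ts. As s is odd, t = 2v, so u = vs
    -- and sn divides e.
    odd⇒N-1∣e : ¬ 2 ∣ s → n ∣ e → suc N-2 ∣ e
    odd⇒N-1∣e s-odd (divides u refl)
      with divides t u*2≡t*s ← ∣.*-cancelʳ-∣ {s} {u ℕ.* 2} n (≡.subst (s ℕ.* n ∣_) (begin
        u ℕ.* n ℕ.* 2     ≡⟨ ℕ.*-assoc u n 2 ⟩
        u ℕ.* (n ℕ.* 2)   ≡⟨ cong (u ℕ.*_) (ℕ.*-comm n 2) ⟩
        u ℕ.* (2 ℕ.* n)   ≡⟨ ℕ.*-assoc u 2 n ⟨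
        u ℕ.* 2 ℕ.* n     ∎) s*n∣e*2)
      with euclidsLemma t s prime[2] (divides u (sym u*2≡t*s))
    ... | inj₂ 2∣s = contradiction 2∣s s-odd
    ... | inj₁ (divides v refl) = ≡.subst (_∣ u ℕ.* n) (sym N-1≡s*n) (∣.*-monoˡ-∣ n
      (divides v (ℕ.*-cancelʳ-≡ u (v ℕ.* s) 2 (begin
        u ℕ.* 2           ≡⟨ u*2≡t*s ⟩
        v ℕ.* 2 ℕ.* s     ≡⟨ ℕ.*-assoc v 2 s ⟩
        v ℕ.* (2 ℕ.* s)   ≡⟨ cong (v ℕ.*_) (ℕ.*-comm 2 s) ⟩
        v ℕ.* (s ℕ.* 2)   ≡⟨ ℕ.*-assoc v s 2 ⟨
        v ℕ.* s ℕ.* 2     ∎))))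

    -- Otherwise -1 = γᵉ = 1, so 2 · 1 = 0 in the field. Together with p · 1 = 0 and p = 1 + 2 · (p
    -- / 2) this forces 1 = 0.
    N-1∤e : ¬ 2 ∣ p → ¬ suc N-2 ∣ e
    N-1∤e p-odd (divides t e≡) = 0≉1 (≈-sym (S.begin
      1#                                   S.≈⟨ F.+-identityʳ 1# ⟨
      1# + 0#                              S.≈⟨ F.+-congˡ (≈-trans (×-congʳ (p ℕ./ 2) 1+1≈0) (×0≈0 (p ℕ./ 2))) ⟨
      1# + (p ℕ./ 2) ×ₙ (2 ×ₙ 1#)          S.≈⟨ F.+-congˡ (×-assocˡ 1# (p ℕ./ 2) 2) ⟩
      (1 ℕ.+ p ℕ./ 2 ℕ.* 2) ×ₙ 1#          S.≡⟨ cong (_×ₙ 1#) p≡ ⟨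
      p ×ₙ 1#                              S.≈⟨ p×1≈0 ⟩
      0#                                   S.∎))
      where
      1≈-1 : 1# ≈ - 1#
      1≈-1 = ≈-sym (≈-trans -1≈γᵉ (≈-trans (reflexive (cong (γ ^_) e≡)) (^-multiple γ^[N-1]≈1 t)))
      1+1≈0 : 2 ×ₙ 1# ≈ 0#
      1+1≈0 = ≈-trans (F.+-congˡ (≈-trans (F.+-identityʳ 1#) 1≈-1)) (F.-‿inverseʳ 1#)
      remainder : ∀ r → r ℕ.< 2 → r ≢ 0 → r ≡ 1
      remainder 0 _ r≢0 = contradiction refl r≢0
      remainder 1 _ _   = refl
      remainder (suc (suc r)) (s≤s (s≤s ())) _
      p≡ : p ≡ 1 ℕ.+ p ℕ./ 2 ℕ.* 2
      p≡ = trans (m≡m%n+[m/n]*n p 2) (cong (ℕ._+ p ℕ./ 2 ℕ.* 2)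
        (remainder (p % 2) (m%n<n p 2) (p-odd ∘ ∣.m%n≡0⇒n∣m p 2)))

  log-1 : ∃[ e ] - 1# ≈ γ ^ e
  log-1 = logarithm (- 1#) (λ -1≈0 → 0≉1 (≈-trans (≈-sym (F.-‿inverseʳ 1#)) (≈-trans (F.+-congˡ -1≈0) (F.+-identityʳ 1#))))

  char2⇒-1≈1 : p ≡ 2 → - 1# ≈ γ ^ 0
  char2⇒-1≈1 p≡2 = ≈-sym (inverseˡ-unique 1# 1# (≈-trans (F.+-congˡ (≈-sym (F.+-identityʳ 1#)))
    (≈-trans (reflexive (cong (_×ₙ 1#) (sym p≡2))) p×1≈0)))

  -- Here sn + 1 = p^m is even, so an even s would make 1 even.
  char2⇒s-odd : 1 ℕ.≤ m → p ≡ 2 → ¬ 2 ∣ s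
  char2⇒s-odd 1≤m p≡2 2∣s = ∣.>⇒∤ (s≤s (s≤s ℕ.z≤n)) (∣.∣m+n∣m⇒∣n {m = suc N-2} {n = 1}
    (≡.subst (2 ∣_) (trans N≡2+ (sym (ℕ.+-comm (suc N-2) 1))) (2∣N m 1≤m))
    (≡.subst (2 ∣_) (sym N-1≡s*n) (∣.∣m⇒∣m*n n 2∣s)))
    where
    2∣N : ∀ m → 1 ℕ.≤ m → 2 ∣ p ℕ.^ m
    2∣N (suc m) _ = ∣.∣m⇒∣m*n (p ℕ.^ m) (∣.∣-reflexive (sym p≡2))

open import Data.Nat.Base using (_≤_; _^_; _∸_)

theorem1 : ∀ {a ℓ} (p m : ℕ) (pr : Prime p) → 1 ≤ m → (p ≡ 2 → 2 ≤ m) →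
    (F : CommutativeRing a ℓ) (isFF : IsFiniteField F (p ^ m)) →
    (γ : CommutativeRing.Carrier F) (prim : IsPrimitive isFF γ) →
    (n : ℕ) → 2 ≤ n → (n∣pᵐ-1 : n ∣ p ^ m ∸ 1) →
    let s = quotient n∣pᵐ-1
        q = PrimitiveElement.Cyclotomic.q {m = m} pr isFF prim n
    in IsSubalgebra p m (Span p q) ×
       (Σ[ c ∈ (Fin n → Fin n → Fin (suc n) → ℤ) ]
         (∀ i j → q (suc i) *ₚ q (suc j)
                    ≡ const (c i j zero / 1) +ₚ ∑ₚ (λ k → (c i j (suc k) / 1) •ₚ q (suc k))
                    mod[x^ p -1]) ×
         (¬ 2 ∣ p → 2 ∣ s →
           ∀ i → c i i zero ≡ + s × (∀ j → j ≢ i → c i j zero ≡ + 0)) ×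
         (¬ 2 ∣ p → ¬ 2 ∣ s →
           ∀ i → c i i zero ≡ + 0 × (∃[ j ] (j ≢ i × c i j zero ≡ + s))) ×
         (p ≡ 2 →
           ¬ 2 ∣ s ×
           (∀ i → c i i zero ≡ + s × (∀ j → j ≢ i → c i j zero ≡ + 0))))
theorem1 p m pr 1≤m _ F isFF γ prim n 2≤n n∣pᵐ-1 =
  isSubalgebra ,
  (λ i j k → + structure (suc i) (suc j) k) ,
  (λ i j → product-expansion (suc i) (suc j)) ,
  (λ p-odd s-even i → let n∣e = even⇒n∣e s-even in
    cong +_ (diagonal n∣e i) , λ j j≢i → cong +_ (off-diagonal n∣e i j j≢i)) ,
  (λ p-odd s-odd i → let n∤e = N-1∤e p-odd ∘ odd⇒N-1∣e s-odd in
    cong +_ (diagonal-0 n∤e i) , opposite n∤e i , opposite≢ n∤e i , cong +_ (opposite-s n∤e i)) ,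
  (λ p≡2 → char2⇒s-odd 1≤m p≡2 , λ i →
    -- In characteristic 2 the exponent 0 is taken as logarithm of -1 = 1 in place of the one found
    -- by `log-1`; n divides it at once, although s is odd.
    cong +_ (Negation.diagonal 0 (char2⇒-1≈1 p≡2) (n ∣.∣0) i) ,
    λ j j≢i → cong +_ (Negation.off-diagonal 0 (char2⇒-1≈1 p≡2) (n ∣.∣0) i j j≢i))
  where
  instance
    n≢0 : NonZero n
    n≢0 = ℕ.>-nonZero (ℕ.≤-trans (s≤s ℕ.z≤n) 2≤n)

  open DiscreteLogarithm {m = m} pr isFF prim using (N-2; N≡2+)

  n∣N-1 : n ∣ suc N-2
  -- The quotient is copied, so that `s` here is definitionally the s of the theorem.
  n∣N-1 = divides (quotient n∣pᵐ-1) (trans (cong ℕ.pred (sym N≡2+)) (_∣_.equality n∣pᵐ-1))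

  open SchurRing {m = m} pr isFF prim n n∣N-1
  open Negation (proj₁ log-1) (proj₂ log-1)
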